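{- Let $X=\{1,12,21,132,213,231,312,2143,2413,3142,3412\}$ (permutations in one-line notation). Let $\sigma$ be a permutation. If $\sigma\in X$, then there exists a constant $c$ such that $|\mathsf{ASM}_n(\sigma)|\le c^n$ for all $n$. Otherwise, $|\mathsf{ASM}_n(\sigma)|\ge \lfloor n/3\rfloor!$ for all $n$.
   Context: An alternating sign matrix (ASM) is a square matrix with entries in $\{0,1,-1\}$ such that every row and every column sums to $1$ and the nonzero entries of each row and each column alternate in sign. A permutation $\pi\in S_k$ is identified with the $k\times k$ matrix whose row $i$ has a $1$ in column $\pi(i)$ and $0$ elsewhere. An $n\times n$ ASM $A$ classically contains $\pi\in S_k$ if there are order-preserving injections $f,g:[k]\to[n]$ with $A_{f(i),g(\pi(i))}=1$ for all $i$; otherwise $A$ classically avoids $\pi$. $\mathsf{ASM}_n(\sigma)$ denotes the set of $n\times n$ ASMs classically avoiding $\sigma$. -}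

module Defs where

open import Data.Nat using (ℕ; zero; suc; _+_; _*_; _^_; _≤_; _<_; _/_; _!)
open import Data.Integer as ℤ using (ℤ; +_; -[1+_])
open import Data.Fin using (Fin; toℕ) renaming (_<_ to _<ᶠ_)
open import Data.Fin.Permutation using (Permutation′; _⟨$⟩ʳ_)
open import Data.List using (List; []; _∷_; map; allFin)
open import Data.List.Membership.Propositional using (_∈_)
open import Data.Vec.Functional using (foldr)
open import Data.Product using (Σ; ∃; ∃-syntax; _×_; _,_)
open import Data.Sum using (_⊎_)
open import Relation.Nullary using (¬_)
open import Relation.Binary.PropositionalEquality using (_≡_; _≢_)

Matrix : ℕ → Set
Matrix n = Fin n → Fin n → ℤ

Σℤ : ∀ {n} → (Fin n → ℤ) → ℤ
Σℤ v = foldr ℤ._+_ (+ 0) v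

Entry : ℤ → Set
Entry x = (x ≡ + 0) ⊎ (x ≡ + 1) ⊎ (x ≡ -[1+ 0 ])

-- the nonzero entries of a line (row or column) v alternate in sign:
-- whenever j < j' are positions of nonzero entries with only zero entries
-- strictly between them, the two entries have opposite signs (i.e. differ,
-- as they both lie in {1,-1}).
Alternating : ∀ {n} → (Fin n → ℤ) → Set
Alternating {n} v =
  (j j' : Fin n) → j <ᶠ j' → v j ≢ + 0 → v j' ≢ + 0 →
  ((l : Fin n) → j <ᶠ l → l <ᶠ j' → v l ≡ + 0) →
  v j ≢ v j'

IsASM : ∀ {n} → Matrix n → Set
IsASM {n} A =
  ((i j : Fin n) → Entry (A i j)) ×
  ((i : Fin n) → Σℤ (λ j → A i j) ≡ + 1) ×
  ((j : Fin n) → Σℤ (λ i → A i j) ≡ + 1) ×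
  ((i : Fin n) → Alternating (λ j → A i j)) ×
  ((j : Fin n) → Alternating (λ i → A i j))

Increasing : ∀ {k n} → (Fin k → Fin n) → Set
Increasing {k} f = (i j : Fin k) → i <ᶠ j → f i <ᶠ f j

Contains : ∀ {n k} → Matrix n → Permutation′ k → Set
Contains {n} {k} A π =
  Σ (Fin k → Fin n) λ f → Σ (Fin k → Fin n) λ g →
    Increasing f × Increasing g ×
    ((i : Fin k) → A (f i) (g (π ⟨$⟩ʳ i)) ≡ + 1)

Avoids : ∀ {n k} → Matrix n → Permutation′ k → Set
Avoids A π = ¬ Contains A π

ASMAvoiding : ∀ {k} → ℕ → Permutation′ k → Set
ASMAvoiding n σ = Σ (Matrix n) λ A → IsASM A × Avoids A σ

SameMatrix : ∀ {n k} {σ : Permutation′ k} → ASMAvoiding n σ → ASMAvoiding n σ → Set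
SameMatrix {n} (A , _) (B , _) = (i j : Fin n) → A i j ≡ B i j

CardLe : ∀ {k} → ℕ → Permutation′ k → ℕ → Set
CardLe n σ m =
  Σ (ASMAvoiding n σ → Fin m) λ h →
    (x y : ASMAvoiding n σ) → h x ≡ h y → SameMatrix {σ = σ} x y

CardGe : ∀ {k} → ℕ → Permutation′ k → ℕ → Set
CardGe n σ m =
  Σ (Fin m → ASMAvoiding n σ) λ h →
    (a b : Fin m) → SameMatrix {σ = σ} (h a) (h b) → a ≡ b

oneLine : ∀ {k} → Permutation′ k → List ℕ
oneLine {k} σ = map (λ i → suc (toℕ (σ ⟨$⟩ʳ i))) (allFin k)

X : List (List ℕ)
X = (1 ∷ [])
  ∷ (1 ∷ 2 ∷ []) ∷ (2 ∷ 1 ∷ [])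
  ∷ (1 ∷ 3 ∷ 2 ∷ []) ∷ (2 ∷ 1 ∷ 3 ∷ []) ∷ (2 ∷ 3 ∷ 1 ∷ []) ∷ (3 ∷ 1 ∷ 2 ∷ [])
  ∷ (2 ∷ 1 ∷ 4 ∷ 3 ∷ []) ∷ (2 ∷ 4 ∷ 1 ∷ 3 ∷ []) ∷ (3 ∷ 1 ∷ 4 ∷ 2 ∷ [])
  ∷ (3 ∷ 4 ∷ 1 ∷ 2 ∷ [])
  ∷ []

InX : ∀ {k} → Permutation′ k → Set
InX σ = oneLine σ ∈ X

{-# OPTIONS --safe #-}
module Submission where

-- A permutation lies in X exactly when each of its points is in the first or last row or column.
-- A point which is not so placed is the middle of a monotone triple: some two of the extremal points
-- lie in opposite quadrants around it.
--
-- If σ contains a decreasing triple, then the 3m × 3m matrices with blocks [0 I 0], [I -π I],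
-- [0 I 0], padded by an identity block, avoid σ for all π ∈ S_m, since their ones lie on two
-- increasing diagonals. For increasing triples, reverse the columns.
--
-- If σ ∈ X, each -1 of an alternating sign matrix has a 1 in all four directions, and moving the
-- points of an occurrence of σ among the -1s outwards to such 1s gives an occurrence among the 1s.
-- So both the 1s and the -1s form 0/1 matrices avoiding σ. By Marcus–Tardos, such matrices have
-- linearly many ones; following Klazar, contract s × s blocks, and record the contents of the
-- (linearly many) nonempty blocks: this gives a code of linear length.

open import Defs
open import Data.Bool using (Bool; true; false; _∧_; _∨_; not; T; if_then_else_)
open import Data.Fin as Fin using (Fin; zero; suc; toℕ; fromℕ; fromℕ<; inject≤; punchIn; opposite; combine; remQuot; funToFin; finToFun; _↑ˡ_; _↑ʳ_) renaming (_<_ to _<ᶠ_)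
open import Data.Fin.Patterns using (0F; 1F; 2F; 3F)
import Data.Fin.Properties as Fin
open import Data.Fin.Permutation using (Permutation′; _⟨$⟩ʳ_; _⟨$⟩ˡ_; inverseˡ; inverseʳ; flip; insert; insert-punchIn; reverse) renaming (id to idₚ)
open import Data.Integer as ℤ using (ℤ; +_; -[1+_])
import Data.Integer.Properties as ℤ
open import Data.List using ([]; _∷_; length; allFin)
open import Data.List.Membership.Propositional using (_∈_)
open import Data.List.Properties using (length-map; length-tabulate; ≡-dec)
open import Data.List.Relation.Unary.All using (All; lookup; all?)
open import Data.List.Relation.Unary.Any using (here)
open import Data.Nat using (ℕ; zero; suc; _+_; _*_; _∸_; _^_; _≤_; _<_; _≤ᵇ_; z≤n; s≤s; _<?_; _/_; _%_; _!)
open import Data.Nat.DivMod using (m≡m%n+[m/n]*n)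
import Data.Nat.Properties as ℕ
open import Data.Nat.Solver using (module +-*-Solver)
open import Data.Product using (Σ; ∃; _×_; _,_; proj₁; proj₂)
open import Data.Sum using (_⊎_; inj₁; inj₂; map)
open import Function using (_∘_)
open import Function.Bundles using (Injection)
open import Function.Properties.Inverse using (↔⇒↣)
open import Relation.Binary.Definitions using (tri<; tri≈; tri>)
open import Relation.Binary.PropositionalEquality
open import Relation.Nullary using (¬_; Dec; yes; no; does; contradiction)
open import Relation.Nullary.Decidable using (_×-dec_; _⊎-dec_; _→-dec_; ¬?; toWitness)
open import Data.List.Membership.DecPropositional (≡-dec ℕ._≟_) using (_∈?_)
open import Algebra.Properties.CommutativeMonoid.Sum ℕ.+-0-commutativeMonoid using (sum; sum-cong-≗; ∑-distrib-+; ∑-comm)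
open import Algebra.Properties.Semiring.Sum ℕ.+-*-semiring using (*-distribˡ-sum; *-distribʳ-sum)
open import Algebra.Properties.CommutativeMonoid.Sum ℤ.+-0-commutativeMonoid using () renaming (sum-permute to Σℤ-permute; sum-cong-≗ to Σℤ-cong)
open +-*-Solver using (solve; _:*_; _:+_; con; _:=_)

-- Counting

sum-mono : ∀ {n} {f g : Fin n → ℕ} → (∀ i → f i ≤ g i) → sum f ≤ sum g
sum-mono {zero}  f≤g = z≤n
sum-mono {suc n} f≤g = ℕ.+-mono-≤ (f≤g zero) (sum-mono (f≤g ∘ suc))

sum-bounded : ∀ {n c} {f : Fin n → ℕ} → (∀ i → f i ≤ c) → sum f ≤ n * c
sum-bounded {zero}  f≤c = z≤n
sum-bounded {suc n} f≤c = ℕ.+-mono-≤ (f≤c zero) (sum-bounded (f≤c ∘ suc))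

sum-+ : ∀ m {n} (f : Fin (m + n) → ℕ) → sum f ≡ sum (λ i → f (i ↑ˡ n)) + sum (λ i → f (m ↑ʳ i))
sum-+ zero    f = refl
sum-+ (suc m) f = trans (cong (λ z → f zero + z) (sum-+ m (f ∘ suc))) (sym (ℕ.+-assoc (f zero) _ _))

sum-combine : ∀ {n s} (f : Fin (n * s) → ℕ) → sum f ≡ sum {n} (λ a → sum (λ x → f (combine a x)))
sum-combine {zero}      f = refl
sum-combine {suc n} {s} f = trans (sum-+ s f)
  (cong (λ z → sum (λ x → f (x ↑ˡ n * s)) + z) (sum-combine {n} (λ i → f (s ↑ʳ i))))

bit : Bool → ℕ
bit false = 0
bit true  = 1

bit≤1 : ∀ b → bit b ≤ 1
bit≤1 false = z≤n
bit≤1 true  = s≤s z≤n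

count : ∀ {n} → (Fin n → Bool) → ℕ
count v = sum (λ i → bit (v i))

any : ∀ {n} → (Fin n → Bool) → Bool
any {zero}  v = false
any {suc n} v = v zero ∨ any (v ∘ suc)

any-intro : ∀ {n} (v : Fin n → Bool) i → v i ≡ true → any v ≡ true
any-intro v zero    eq rewrite eq = refl
any-intro v (suc i) eq with v zero
... | true  = refl
... | false = any-intro (v ∘ suc) i eq

any-witness : ∀ {n} (v : Fin n → Bool) → any v ≡ true → ∃ λ i → v i ≡ true
any-witness {suc n} v eq with v zero in v0
... | true  = zero , v0
... | false = let i , vi = any-witness (v ∘ suc) eq in suc i , vi

-- Supplies the increasing row and column maps from which an occurrence is assembled; the first `k`
-- marked positions are taken.
select : ∀ {n} k (v : Fin n → Bool) → k ≤ count v →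
  Σ (Fin k → Fin n) λ h → Increasing h × (∀ i → v (h i) ≡ true)
select zero v _ = (λ ()) , (λ ()) , λ ()
select {suc n} (suc k) v k≤ with v zero in v0
select {suc n} (suc k) v (s≤s k≤) | true = h′ , incr , spec
  where
  r = select k (v ∘ suc) k≤
  h′ : Fin (suc k) → Fin (suc n)
  h′ zero    = zero
  h′ (suc i) = suc (proj₁ r i)
  incr : Increasing h′
  incr zero    (suc j) _         = s≤s z≤n
  incr (suc i) (suc j) (s≤s i<j) = s≤s (proj₁ (proj₂ r) i j i<j)
  spec : ∀ i → v (h′ i) ≡ true
  spec zero    = v0
  spec (suc i) = proj₂ (proj₂ r) i
... | false =
  let h , incr , spec = select (suc k) (v ∘ suc) k≤
  in suc ∘ h , (λ i j i<j → s≤s (incr i j i<j)) , spec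

count-split : ∀ {n} (w c : Fin n → Bool) → count w ≡ count (λ a → w a ∧ c a) + count (λ a → w a ∧ not (c a))
count-split w c = trans (sum-cong-≗ (λ a → split (w a) (c a)))
  (∑-distrib-+ (λ a → bit (w a ∧ c a)) (λ a → bit (w a ∧ not (c a))))
  where
  split : ∀ x y → bit x ≡ bit (x ∧ y) + bit (x ∧ not y)
  split false _     = refl
  split true  false = refl
  split true  true  = refl

∧-true : ∀ {x y} → x ∧ y ≡ true → x ≡ true × y ≡ true
∧-true {true} {true} _ = refl , refl

not-true : ∀ {x} → not x ≡ true → x ≡ false
not-true {false} _ = refl

-- Induction on `s`, splitting `w` by the value of `χ a zero`. Within either half, agreement in the
-- remaining coordinates is agreement in all of them, so the hypothesis passes on; the `2 ^ s`
-- classes are never listed.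
pigeonhole : ∀ {n m} s (χ : Fin n → Fin s → Bool) (w : Fin n → Bool) →
  (∀ u → (∀ a → u a ≡ true → w a ≡ true) →
     (∀ a a′ → u a ≡ true → u a′ ≡ true → ∀ y → χ a y ≡ χ a′ y) → count u ≤ m) →
  count w ≤ 2 ^ s * m
pigeonhole {m = m} zero χ w small = ℕ.≤-trans (small w (λ _ e → e) (λ _ _ _ _ ())) (ℕ.m≤m+n m 0)
pigeonhole {m = m} (suc s) χ w small = begin
  count w                          ≡⟨ count-split w (λ a → χ a zero) ⟩
  count w⁺ + count w⁻              ≤⟨ ℕ.+-mono-≤ bound⁺ bound⁻ ⟩
  2 ^ s * m + 2 ^ s * m            ≡⟨ ℕ.*-distribʳ-+ m (2 ^ s) (2 ^ s) ⟨
  (2 ^ s + 2 ^ s) * m              ≡⟨ cong (λ z → (2 ^ s + z) * m) (ℕ.+-identityʳ (2 ^ s)) ⟨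
  2 ^ suc s * m                    ∎
  where
  open ℕ.≤-Reasoning
  w⁺ = λ a → w a ∧ χ a zero
  w⁻ = λ a → w a ∧ not (χ a zero)
  bound⁺ = pigeonhole s (λ a y → χ a (suc y)) w⁺ λ u u⊆ agree →
    small u (λ a ua → proj₁ (∧-true (u⊆ a ua))) λ where
      a a′ ua ua′ zero    → trans (proj₂ (∧-true {w a} (u⊆ a ua))) (sym (proj₂ (∧-true {w a′} (u⊆ a′ ua′))))
      a a′ ua ua′ (suc y) → agree a a′ ua ua′ y
  bound⁻ = pigeonhole s (λ a y → χ a (suc y)) w⁻ λ u u⊆ agree →
    small u (λ a ua → proj₁ (∧-true (u⊆ a ua))) λ where
      a a′ ua ua′ zero    → trans (not-true (proj₂ (∧-true {w a} (u⊆ a ua))))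
                                    (sym (not-true (proj₂ (∧-true {w a′} (u⊆ a′ ua′)))))
      a a′ ua ua′ (suc y) → agree a a′ ua ua′ y

-- Zero-one matrices, pattern occurrences and block contraction

BMat : ℕ → Set
BMat n = Fin n → Fin n → Bool

Occurs : ∀ {n k} → Permutation′ k → BMat n → Set
Occurs {n} {k} π M =
  Σ (Fin k → Fin n) λ f → Σ (Fin k → Fin n) λ g →
    Increasing f × Increasing g × (∀ i → M (f i) (g (π ⟨$⟩ʳ i)) ≡ true)

transposed : ∀ {n} → BMat n → BMat n
transposed M i j = M j i

-- Row and column maps trade places. This derives the bound on tall blocks from the one on wide
-- blocks.
occurs-transposed : ∀ {n k} (π : Permutation′ k) (M : BMat n) → Occurs (flip π) (transposed M) → Occurs π M
occurs-transposed π M (f , g , f↑ , g↑ , hit) = g , f , g↑ , f↑ ,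
  λ i → subst (λ z → M (g z) (f (π ⟨$⟩ʳ i)) ≡ true) (inverseˡ π) (hit (π ⟨$⟩ʳ i))

ones : ∀ {n} → BMat n → ℕ
ones M = sum (λ i → count (M i))

block : ∀ {n s} → BMat (n * s) → Fin n → Fin n → BMat s
block M a b x y = M (combine a x) (combine b y)

contract : ∀ {n s} → BMat (n * s) → BMat n
contract {s = s} M a b = any (λ x → any (λ y → block {s = s} M a b x y))

ones-blocks : ∀ {n s} (M : BMat (n * s)) → ones M ≡ sum (λ a → sum (λ b → ones (block {n} {s} M a b)))
ones-blocks {n} {s} M = begin
  sum (λ i → count (M i))
    ≡⟨ sum-combine {n} {s} (λ i → count (M i)) ⟩
  sum {n} (λ a → sum {s} (λ x → count (M (combine a x))))
    ≡⟨ sum-cong-≗ {n} (λ a → sum-cong-≗ {s} (λ x → sum-combine {n} {s} (λ j → bit (M (combine a x) j)))) ⟩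
  sum {n} (λ a → sum {s} (λ x → sum {n} (λ b → count (block {n} {s} M a b x))))
    ≡⟨ sum-cong-≗ {n} (λ a → ∑-comm {s} {n} (λ x b → count (block {n} {s} M a b x))) ⟩
  sum {n} (λ a → sum {n} (λ b → ones (block {n} {s} M a b))) ∎
  where open ≡-Reasoning

block-nonempty : ∀ {n s} (M : BMat (n * s)) a b →
  contract {n} {s} M a b ≡ true → ∃ λ x → ∃ λ y → block {n} {s} M a b x y ≡ true
block-nonempty M a b ne =
  let x , nex = any-witness _ ne
      y , hit = any-witness _ nex
  in x , y , hit

-- One true entry is chosen in each block used. Different pattern rows and columns use different
-- block rows and columns, so the offsets inside the blocks cannot disturb the order. Offsets are
-- indexed by pattern rows, hence `π ⟨$⟩ˡ j` in the column map.
occurs-contract : ∀ {n s k} (π : Permutation′ k) (M : BMat (n * s)) → Occurs π (contract {n} {s} M) → Occurs π M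
occurs-contract {n} {s} π M (f , g , f↑ , g↑ , hit) =
  (λ i → combine (f i) (x i)) , (λ j → combine (g j) (y (π ⟨$⟩ˡ j))) ,
  (λ i j i<j → Fin.combine-monoˡ-< (x i) (x j) (f↑ i j i<j)) ,
  (λ i j i<j → Fin.combine-monoˡ-< (y _) (y _) (g↑ i j i<j)) ,
  λ i → subst (λ z → M (combine (f i) (x i)) (combine (g (π ⟨$⟩ʳ i)) (y z)) ≡ true)
          (sym (inverseˡ π)) (proj₂ (proj₂ (at i)))
  where
  at : ∀ i → ∃ λ x → ∃ λ y → block {n} {s} M (f i) (g (π ⟨$⟩ʳ i)) x y ≡ true
  at i = block-nonempty {n} {s} M _ _ (hit i)
  x = λ i → proj₁ (at i)
  y = λ i → proj₁ (proj₂ (at i))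

-- The Marcus–Tardos bound

≤ᵇ-true : ∀ i j → (i ≤ᵇ j) ≡ true → i ≤ j
≤ᵇ-true i j e = ℕ.≤ᵇ⇒≤ i j (subst T (sym e) _)

≤ᵇ-false : ∀ i j → (suc i ≤ᵇ j) ≡ false → j ≤ i
≤ᵇ-false i j e with ℕ.≤-<-connex j i
... | inj₁ j≤i = j≤i
... | inj₂ i<j = contradiction (subst T e (ℕ.≤⇒≤ᵇ i<j)) λ ()

module _ {n s : ℕ} (M : BMat (n * s)) where

  columnHit : Fin n → Fin n → Fin s → Bool
  columnHit a b y = any (λ x → block {n} {s} M a b x y)

  -- The threshold is `suc m`, the length of the pattern: a wide block has room for all its columns.
  wide : ℕ → Fin n → Fin n → Bool
  wide m a b = suc m ≤ᵇ count (columnHit a b)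

  -- Suppose `m + 1` wide blocks of one block column share their set of hit columns. Fixing `m + 1`
  -- of these columns and taking row `i` of the pattern from the `i`-th block yields every pattern
  -- of that length. There are `2 ^ s` possible column sets.
  wide-count : ∀ {m} (π : Permutation′ (suc m)) → ¬ Occurs π M →
    ∀ b → count (λ a → wide m a b) ≤ 2 ^ s * m
  wide-count {m} π avoids b = pigeonhole s (λ a → columnHit a b) (λ a → wide m a b) small
    where
    small : ∀ u → (∀ a → u a ≡ true → wide m a b ≡ true) →
      (∀ a a′ → u a ≡ true → u a′ ≡ true → ∀ y → columnHit a b y ≡ columnHit a′ b y) → count u ≤ m
    small u u⊆ agree with ℕ.≤-<-connex (count u) m
    ... | inj₁ ok = ok
    ... | inj₂ m<u = contradiction occurs avoids
      where
      rows = select (suc m) u m<u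
      a = proj₁ rows
      -- The columns are chosen in the first selected block; by `agree` every other selected block
      -- hits them too.
      columns = select (suc m) (columnHit (a zero) b) (≤ᵇ-true (suc m) _ (u⊆ _ (proj₂ (proj₂ rows) zero)))
      y = proj₁ columns
      at : ∀ i → ∃ λ x → block {n} {s} M (a i) b x (y (π ⟨$⟩ʳ i)) ≡ true
      at i = any-witness _ (trans (agree _ _ (proj₂ (proj₂ rows) i) (proj₂ (proj₂ rows) zero) _)
                                  (proj₂ (proj₂ columns) (π ⟨$⟩ʳ i)))
      occurs : Occurs π M
      occurs = (λ i → combine (a i) (proj₁ (at i))) , (λ j → combine b (y j)) ,
        (λ i j i<j → Fin.combine-monoˡ-< _ _ (proj₁ (proj₂ rows) i j i<j)) ,
        (λ i j i<j → combine-monoʳ-< b (proj₁ (proj₂ columns) i j i<j)) ,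
        (λ i → proj₂ (at i))
        where
        combine-monoʳ-< : ∀ {i j : Fin s} (b : Fin n) → i <ᶠ j → combine b i <ᶠ combine b j
        combine-monoʳ-< {i} {j} b i<j = subst₂ _<_ (sym (Fin.toℕ-combine b i)) (sym (Fin.toℕ-combine b j))
          (ℕ.+-monoʳ-< (s * toℕ b) i<j)

tall : ∀ {n s} → BMat (n * s) → ℕ → Fin n → Fin n → Bool
tall {n} {s} M m a b = wide {n} {s} (transposed M) m b a

-- Every one lies at the crossing of a nonempty row and a nonempty column, so the inequality holds
-- entry by entry.
ones≤rows*columns : ∀ {s} (B : BMat s) →
  ones B ≤ count (λ x → any (B x)) * count (λ y → any (λ x → B x y))
ones≤rows*columns {s} B = begin
  ones B
    ≤⟨ sum-mono {s} (λ x → sum-mono {s} (λ y → entry x y)) ⟩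
  sum {s} (λ x → sum {s} (λ y → r x * c y))
    ≡⟨ sum-cong-≗ {s} (λ x → *-distribˡ-sum (r x) c) ⟨
  sum {s} (λ x → r x * sum c)
    ≡⟨ *-distribʳ-sum (sum c) r ⟨
  sum r * sum c ∎
  where
  open ℕ.≤-Reasoning
  r = λ x → bit (any (B x))
  c = λ y → bit (any (λ x → B x y))
  entry : ∀ x y → bit (B x y) ≤ r x * c y
  entry x y with B x y in eq
  ... | false = z≤n
  ... | true rewrite any-intro (B x) y eq | any-intro (λ x → B x y) x eq = ℕ.≤-refl

ones≤area : ∀ {s} (B : BMat s) → ones B ≤ s * s
ones≤area {s} B = sum-bounded {s} (λ x → subst (count (B x) ≤_) (ℕ.*-identityʳ s) (sum-bounded {s} (λ y → bit≤1 (B x y))))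

any-false : ∀ {n} (v : Fin n → Bool) → any v ≡ false → ∀ i → v i ≡ false
any-false v eq i with v i in vi
... | false = refl
... | true with () ← trans (sym (any-intro v i vi)) eq

-- An empty block contributes nothing; a nonempty block that is neither wide nor tall has its ones
-- in at most `m` rows and `m` columns; a wide or tall one is bounded by its area.
ones-block≤ : ∀ {n s} (M : BMat (n * s)) m a b →
  ones (block {n} {s} M a b) ≤
    m * m * bit (contract {n} {s} M a b) + s * s * (bit (wide {n} {s} M m a b) + bit (tall {n} {s} M m a b))
ones-block≤ {n} {s} M m a b with contract {n} {s} M a b in ne
... | false = ℕ.≤-trans
  (ℕ.≤-reflexive (trans (sum-cong-≗ {s} (λ x → trans
    (sum-cong-≗ {s} (λ y → cong bit (any-false _ (any-false _ ne x) y))) (zeros s))) (zeros s))) z≤n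
  where
  zeros : ∀ n → sum {n} (λ _ → 0) ≡ 0
  zeros zero    = refl
  zeros (suc n) = zeros n
... | true with wide {n} {s} M m a b in w | tall {n} {s} M m a b in t
...   | false | false = begin
  ones B                    ≤⟨ ones≤rows*columns B ⟩
  rows * columns            ≤⟨ ℕ.*-mono-≤ (≤ᵇ-false m rows t) (≤ᵇ-false m columns w) ⟩
  m * m                     ≡⟨ ℕ.*-identityʳ (m * m) ⟨
  m * m * 1                 ≤⟨ ℕ.m≤m+n _ _ ⟩
  m * m * 1 + s * s * 0     ∎
  where
  open ℕ.≤-Reasoning
  B = block {n} {s} M a b
  rows = count (λ x → any (B x))
  columns = count (λ y → any (λ x → B x y))
...   | true | t′ = begin
  ones (block {n} {s} M a b)           ≤⟨ ones≤area (block {n} {s} M a b) ⟩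
  s * s                                ≤⟨ ℕ.m≤m*n (s * s) (1 + bit t′) ⟩
  s * s * (1 + bit t′)                 ≤⟨ ℕ.m≤n+m _ (m * m * 1) ⟩
  m * m * 1 + s * s * (1 + bit t′)     ∎
  where open ℕ.≤-Reasoning
...   | false | true = begin
  ones (block {n} {s} M a b)           ≤⟨ ones≤area (block {n} {s} M a b) ⟩
  s * s                                ≡⟨ ℕ.*-identityʳ (s * s) ⟨
  s * s * 1                            ≤⟨ ℕ.m≤n+m _ (m * m * 1) ⟩
  m * m * 1 + s * s * 1                ∎
  where open ℕ.≤-Reasoning

-- The Marcus-Tardos recursion: the bound for single blocks, summed over all blocks.
ones≤contract : ∀ {n s m} (π : Permutation′ (suc m)) (M : BMat (n * s)) → ¬ Occurs π M →
  ones M ≤ m * m * ones (contract {n} {s} M) + n * (s * s * (2 ^ s * m + 2 ^ s * m))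
ones≤contract {n} {s} {m} π M avoids = begin
  ones M
    ≡⟨ ones-blocks {n} {s} M ⟩
  sum {n} (λ a → sum {n} (λ b → ones (block {n} {s} M a b)))
    ≤⟨ sum-mono {n} (λ a → sum-mono {n} (λ b → ones-block≤ {n} {s} M m a b)) ⟩
  sum {n} (λ a → sum {n} (λ b → m * m * c a b + s * s * (w a b + t a b)))
    ≡⟨ sum-cong-≗ {n} (λ a → ∑-distrib-+ {n} (λ b → m * m * c a b) (λ b → s * s * (w a b + t a b))) ⟩
  sum {n} (λ a → sum {n} (λ b → m * m * c a b) + sum {n} (λ b → s * s * (w a b + t a b)))
    ≡⟨ ∑-distrib-+ {n} _ _ ⟩
  sum {n} (λ a → sum {n} (λ b → m * m * c a b)) + sum {n} (λ a → sum {n} (λ b → s * s * (w a b + t a b)))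
    ≡⟨ cong₂ _+_ (pull (m * m) c) (pull (s * s) (λ a b → w a b + t a b)) ⟨
  m * m * ones (contract {n} {s} M) + s * s * sum {n} (λ a → sum {n} (λ b → w a b + t a b))
    ≤⟨ ℕ.+-monoʳ-≤ (m * m * ones (contract {n} {s} M)) (ℕ.*-monoʳ-≤ (s * s) wide+tall) ⟩
  m * m * ones (contract {n} {s} M) + s * s * (n * W + n * W)
    ≡⟨ cong (λ z → m * m * ones (contract {n} {s} M) + z) (rearrange n W (s * s)) ⟩
  m * m * ones (contract {n} {s} M) + n * (s * s * (W + W)) ∎
  where
  open ℕ.≤-Reasoning
  W = 2 ^ s * m
  c = λ a b → bit (contract {n} {s} M a b)
  w = λ a b → bit (wide {n} {s} M m a b)
  t = λ a b → bit (tall {n} {s} M m a b)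
  pull : ∀ k (f : Fin n → Fin n → ℕ) →
    k * sum {n} (λ a → sum {n} (f a)) ≡ sum {n} (λ a → sum {n} (λ b → k * f a b))
  pull k f = trans (*-distribˡ-sum {n} k (λ a → sum {n} (f a))) (sum-cong-≗ {n} (λ a → *-distribˡ-sum k (f a)))
  rearrange : ∀ n W q → q * (n * W + n * W) ≡ n * (q * (W + W))
  rearrange = solve 3 (λ n W q → q :* (n :* W :+ n :* W) := n :* (q :* (W :+ W))) refl
  wide+tall : sum {n} (λ a → sum {n} (λ b → w a b + t a b)) ≤ n * W + n * W
  wide+tall = begin
    sum {n} (λ a → sum {n} (λ b → w a b + t a b))
      ≡⟨ sum-cong-≗ {n} (λ a → ∑-distrib-+ {n} (w a) (t a)) ⟩
    sum {n} (λ a → sum {n} (w a) + sum {n} (t a))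
      ≡⟨ ∑-distrib-+ {n} _ _ ⟩
    sum {n} (λ a → sum {n} (w a)) + sum {n} (λ a → sum {n} (t a))
      -- Wide blocks are bounded along block columns and tall ones along block rows, so only the
      -- first double sum changes its order.
      ≡⟨ cong (λ z → z + sum {n} (λ a → sum {n} (t a))) (∑-comm {n} {n} w) ⟩
    sum {n} (λ b → sum {n} (λ a → w a b)) + sum {n} (λ a → sum {n} (t a))
      ≤⟨ ℕ.+-mono-≤
           (sum-bounded {n} (wide-count {n} {s} M π avoids))
           (sum-bounded {n} (wide-count {n} {s} (transposed M) (flip π)
             (avoids ∘ occurs-transposed π M))) ⟩
    n * W + n * W ∎

-- Coding

-- The power `s ^ t`, with the new factor on the right so that `size s (suc t)` unfolds to the form
-- `n * s` used by blocks.
size : ℕ → ℕ → ℕ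
size s zero    = 1
size s (suc t) = size s t * s

-- Per block column (row), at most 2 ^ s * m wide (tall) blocks, with at most s * s ones each.
density : ℕ → ℕ → ℕ
density s m = s * s * (2 ^ s * m + 2 ^ s * m)

-- With `C = suc D`, the recursion gives at most `m² C N + N D`, which is at most `(m² + 1) C N`,
-- and `m² < s` turns this into `C N s`. The successor in `C` pays for the single entry at size 1.
ones-linear : ∀ {m} s → m * m < s → (π : Permutation′ (suc m)) → ∀ t (M : BMat (size s t)) →
  ¬ Occurs π M → ones M ≤ suc (density s m) * size s t
ones-linear {m} s m²<s π zero M avoids = begin
  ones M                       ≤⟨ ones≤area M ⟩
  1                            ≤⟨ s≤s z≤n ⟩
  suc (density s m)            ≡⟨ ℕ.*-identityʳ _ ⟨
  suc (density s m) * 1        ∎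
  where open ℕ.≤-Reasoning
ones-linear {m} s m²<s π (suc t) M avoids = begin
  ones M
    ≤⟨ ones≤contract {size s t} {s} π M avoids ⟩
  m * m * ones (contract {size s t} {s} M) + size s t * D
    ≤⟨ ℕ.+-monoˡ-≤ (size s t * D) (ℕ.*-monoʳ-≤ (m * m)
         (ones-linear s m²<s π t _ (avoids ∘ occurs-contract {size s t} {s} π M))) ⟩
  m * m * (suc D * size s t) + size s t * D
    ≤⟨ ℕ.+-monoʳ-≤ (m * m * (suc D * size s t)) (ℕ.*-monoʳ-≤ (size s t) (ℕ.n≤1+n D)) ⟩
  m * m * (suc D * size s t) + size s t * suc D
    ≡⟨ rearrange (m * m) (suc D) (size s t) ⟩
  suc D * size s t * suc (m * m)
    ≤⟨ ℕ.*-monoʳ-≤ (suc D * size s t) m²<s ⟩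
  suc D * size s t * s
    ≡⟨ ℕ.*-assoc (suc D) (size s t) s ⟩
  suc D * size s (suc t) ∎
  where
  open ℕ.≤-Reasoning
  D = density s m
  rearrange : ∀ x d n → x * (d * n) + n * d ≡ d * n * suc x
  rearrange = solve 3 (λ x d n → x :* (d :* n) :+ n :* d := d :* n :* (con 1 :+ x)) refl

-- The list of the values at marked positions is cut, or padded with d, to length Q.
listMarked : ∀ {P K} → (Fin P → Bool) → (Fin P → Fin K) → ∀ Q → Fin K → Fin Q → Fin K
listMarked {zero}  μ v Q       d = λ _ → d
listMarked {suc P} μ v zero    d = λ ()
listMarked {suc P} μ v (suc Q) d = if μ zero
  then (λ { zero → v zero ; (suc q) → listMarked (μ ∘ suc) (v ∘ suc) Q d q })
  else listMarked (μ ∘ suc) (v ∘ suc) (suc Q) d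

-- Equal marks make both lists read the same positions, and `count μ ≤ Q` ensures that no marked
-- value is cut off.
listMarked-injective : ∀ {P K} {μ μ′ : Fin P → Bool} {v v′ : Fin P → Fin K} {Q d} →
  (∀ p → μ p ≡ μ′ p) → count μ ≤ Q →
  (∀ q → listMarked μ v Q d q ≡ listMarked μ′ v′ Q d q) →
  ∀ p → μ p ≡ true → v p ≡ v′ p
listMarked-injective {suc P} {μ = μ} {Q = zero} agree few same p marked with μ zero in μ0
listMarked-injective {suc P} {μ = μ} {Q = zero} agree few same zero marked | false
  with () ← trans (sym μ0) marked
listMarked-injective {suc P} {μ = μ} {v = v} {v′} {Q = zero} {d} agree few same (suc p) marked | false =
  listMarked-injective {v = v ∘ suc} {v′ ∘ suc} {zero} {d} (agree ∘ suc) few (λ ()) p marked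
listMarked-injective {suc P} {μ = μ} {μ′} {v} {v′} {suc Q} {d} agree few same p marked
  with μ zero in μ0 | μ′ zero | agree zero
listMarked-injective {suc P} {Q = suc Q} agree (s≤s few) same zero marked | true | true | refl = same zero
listMarked-injective {suc P} {v = v} {v′} {suc Q} {d} agree (s≤s few) same (suc p) marked | true | true | refl =
  listMarked-injective {v = v ∘ suc} {v′ ∘ suc} {Q} {d} (agree ∘ suc) few (same ∘ suc) p marked
listMarked-injective {suc P} {Q = suc Q} agree few same zero marked | false | false | refl
  with () ← trans (sym μ0) marked
listMarked-injective {suc P} {v = v} {v′} {suc Q} {d} agree few same (suc p) marked | false | false | refl =
  listMarked-injective {v = v ∘ suc} {v′ ∘ suc} {suc Q} {d} (agree ∘ suc) few same p marked

funToFin-injective : ∀ {m n} (f g : Fin m → Fin n) → funToFin f ≡ funToFin g → ∀ i → f i ≡ g i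
funToFin-injective f g eq i = begin
  f i                        ≡⟨ Fin.finToFun-funToFin f i ⟨
  finToFun (funToFin f) i    ≡⟨ cong (λ z → finToFun z i) eq ⟩
  finToFun (funToFin g) i    ≡⟨ Fin.finToFun-funToFin g i ⟩
  g i                        ∎
  where open ≡-Reasoning

index : Bool → Fin 2
index false = zero
index true  = suc zero

index-injective : ∀ {x y} → index x ≡ index y → x ≡ y
index-injective {false} {false} _ = refl
index-injective {true}  {true}  _ = refl

flatten : ∀ {n} {A : Set} → (Fin n → Fin n → A) → Fin (n * n) → A
flatten {n} F p = F (proj₁ (remQuot {n} n p)) (proj₂ (remQuot {n} n p))

flatten-combine : ∀ {n} {A : Set} (F : Fin n → Fin n → A) a b → flatten F (combine a b) ≡ F a b
flatten-combine {n} F a b = cong (λ z → F (proj₁ z) (proj₂ z)) (Fin.remQuot-combine {n} {n} a b)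

encode : ∀ {s} → BMat s → Fin (2 ^ (s * s))
encode B = funToFin (λ p → index (flatten B p))

encode-injective : ∀ {s} (B B′ : BMat s) → encode B ≡ encode B′ → ∀ x y → B x y ≡ B′ x y
encode-injective B B′ eq x y = begin
  B x y                         ≡⟨ flatten-combine B x y ⟨
  flatten B (combine x y)       ≡⟨ index-injective (funToFin-injective _ _ eq (combine x y)) ⟩
  flatten B′ (combine x y)      ≡⟨ flatten-combine B′ x y ⟩
  B′ x y                        ∎
  where open ≡-Reasoning

count-flatten : ∀ {n} (M : BMat n) → count (flatten M) ≡ ones M
count-flatten {n} M = trans (sum-combine {n} {n} (λ p → bit (flatten M p)))
  (sum-cong-≗ {n} (λ a → sum-cong-≗ {n} (λ b → cong bit (flatten-combine M a b))))

-- Codes for zero-one matrices avoiding a pattern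

record Coding {k} (π : Permutation′ k) (n K : ℕ) : Set where
  field
    code           : BMat n → Fin K
    code-injective : ∀ M W → ¬ Occurs π M → ¬ Occurs π W → code M ≡ code W → ∀ i j → M i j ≡ W i j

open Coding

widen : ∀ {k} {π : Permutation′ k} {n K L} → K ≤ L → Coding π n K → Coding π n L
widen K≤L c .code M = inject≤ (code c M) K≤L
widen K≤L c .code-injective M W avM avW eq =
  code-injective c M W avM avW (Fin.inject≤-injective K≤L K≤L _ _ eq)

empty-block : ∀ {n s} (M : BMat (n * s)) {a b} →
  contract {n} {s} M a b ≡ false → ∀ x y → block {n} {s} M a b x y ≡ false
empty-block M none x y = any-false _ (any-false _ none x) y

-- The code of the contraction determines which blocks are nonempty, so it suffices to append the
-- contents of those blocks in order. The contraction avoids `π` as well, hence there are at most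
-- `Q` of them, each with `2 ^ (s * s)` possible contents.
refine : ∀ {k} {π : Permutation′ k} {n s K Q} →
  (∀ (M : BMat n) → ¬ Occurs π M → ones M ≤ Q) →
  Coding π n K → Coding π (n * s) (K * (2 ^ (s * s)) ^ Q)
refine {π = π} {n} {s} {K} {Q} few c = record { code = combined ; code-injective = injective }
  where
  contract′ = contract {n} {s}
  block′ = block {n} {s}
  blockCodes : BMat (n * s) → Fin (n * n) → Fin (2 ^ (s * s))
  blockCodes M p = flatten {n} (λ a b → encode (block′ M a b)) p
  -- Filler for lists shorter than `Q`; decoding reads marked positions only.
  blank : Fin (2 ^ (s * s))
  blank = encode {s} (λ _ _ → false)
  details : BMat (n * s) → Fin Q → Fin (2 ^ (s * s))
  details M = listMarked (flatten (contract′ M)) (blockCodes M) Q blank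
  combined : BMat (n * s) → Fin (K * (2 ^ (s * s)) ^ Q)
  combined M = combine (code c (contract′ M)) (funToFin (details M))

  module _ (M W : BMat (n * s)) (avM : ¬ Occurs π M) (avW : ¬ Occurs π W) (eq : combined M ≡ combined W) where

    parts = Fin.combine-injective (code c (contract′ M)) _ (code c (contract′ W)) _ eq

    contracts : ∀ a b → contract′ M a b ≡ contract′ W a b
    contracts = code-injective c (contract′ M) (contract′ W)
      (avM ∘ occurs-contract {n} {s} π M) (avW ∘ occurs-contract {n} {s} π W) (proj₁ parts)

    blocks : ∀ a b x y → block′ M a b x y ≡ block′ W a b x y
    blocks a b x y with contract′ M a b in ne
    ... | false = trans (empty-block {n} {s} M ne x y)
                        (sym (empty-block {n} {s} W (trans (sym (contracts a b)) ne) x y))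
    ... | true  = encode-injective (block′ M a b) (block′ W a b) (begin
      encode (block′ M a b)          ≡⟨ flatten-combine {n} (λ a b → encode (block′ M a b)) a b ⟨
      blockCodes M (combine a b)     ≡⟨ listMarked-injective {v = blockCodes M} {blockCodes W} {Q} {blank}
                                          (λ p → contracts _ _)
                                          (subst (_≤ Q) (sym (count-flatten (contract′ M)))
                                            (few (contract′ M) (avM ∘ occurs-contract {n} {s} π M)))
                                          (funToFin-injective (details M) (details W) (proj₂ parts))
                                          (combine a b)
                                          (trans (flatten-combine (contract′ M) a b) ne) ⟩
      blockCodes W (combine a b)     ≡⟨ flatten-combine {n} (λ a b → encode (block′ W a b)) a b ⟩
      encode (block′ W a b)          ∎) x y
      where open ≡-Reasoning

    injective : ∀ i j → M i j ≡ W i j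
    injective i j = subst₂ (λ i j → M i j ≡ W i j)
      (Fin.combine-remQuot {n} s i) (Fin.combine-remQuot {n} s j)
      (blocks (proj₁ (remQuot {n} s i)) (proj₁ (remQuot {n} s j)) (proj₂ (remQuot {n} s i)) (proj₂ (remQuot {n} s j)))

-- The factor 2 covers the matrices of size 1; the other factor is the cost of block contents per
-- row of the contraction.
base : ℕ → ℕ → ℕ
base s m = 2 * (2 ^ (s * s)) ^ suc (density s m)

-- With `N` the size of the contraction and `B` the base, the contraction and the block contents
-- each cost at most `B ^ N`. Together this is `B ^ (N * 2)`, within `B ^ (N * s)`, so one base
-- serves all `t`.
size-coding : ∀ {m} s → m * m < s → 2 ≤ s → (π : Permutation′ (suc m)) → ∀ t →
  Coding π (size s t) (base s m ^ size s t)
size-coding {m} s m²<s 2≤s π zero = widen 2≤base record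
  { code = λ M → index (M zero zero)
  ; code-injective = λ { M W _ _ eq zero zero → index-injective eq }
  }
  where
  2≤base : 2 ≤ base s m ^ 1
  2≤base = subst (2 ≤_) (sym (ℕ.*-identityʳ (base s m)))
    (ℕ.m≤m*n 2 ((2 ^ (s * s)) ^ suc (density s m))
      {{ℕ.m^n≢0 (2 ^ (s * s)) (suc (density s m)) {{ℕ.m^n≢0 2 (s * s)}}}})
size-coding {m} s m²<s 2≤s π (suc t) = widen bound
  (refine {n = size s t} {s} (λ M → ones-linear s m²<s π t M) (size-coding s m²<s 2≤s π t))
  where
  open ℕ.≤-Reasoning
  N = size s t
  K = 2 ^ (s * s)
  C = suc (density s m)
  B = base s m
  instance
    _ = ℕ.m^n≢0 2 (s * s)
    _ = ℕ.m^n≢0 K C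
    _ = ℕ.m*n≢0 2 (K ^ C)
  bound : B ^ N * K ^ (C * N) ≤ B ^ (N * s)
  bound = begin
    B ^ N * K ^ (C * N)      ≡⟨ cong (B ^ N *_) (ℕ.^-*-assoc K C N) ⟨
    B ^ N * (K ^ C) ^ N      ≤⟨ ℕ.*-monoʳ-≤ (B ^ N) (ℕ.^-monoˡ-≤ N (ℕ.m≤n*m (K ^ C) 2)) ⟩
    B ^ N * B ^ N            ≡⟨ ℕ.^-distribˡ-+-* B N N ⟨
    B ^ (N + N)              ≡⟨ cong (B ^_) (trans (cong (λ z → N + z) (sym (ℕ.+-identityʳ N))) (ℕ.*-comm 2 N)) ⟩
    B ^ (N * 2)              ≤⟨ ℕ.^-monoʳ-≤ B (ℕ.*-monoʳ-≤ N 2≤s) ⟩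
    B ^ (N * s)              ∎

-- From alternating sign matrices to their ones and minus ones

does-true : ∀ {P : Set} (p? : Dec P) → does p? ≡ true → P
does-true (yes p) _ = p

-- Padding a matrix up to a power of the block size

module _ {n N : ℕ} (M : BMat n) where

  extend : BMat N
  extend i j with toℕ i <? n | toℕ j <? n
  ... | yes i<n | yes j<n = M (fromℕ< i<n) (fromℕ< j<n)
  ... | _       | _       = false

  extend-inside : ∀ i j (i<n : toℕ i < n) (j<n : toℕ j < n) → extend i j ≡ M (fromℕ< i<n) (fromℕ< j<n)
  extend-inside i j i<n j<n with toℕ i <? n | toℕ j <? n
  ... | yes _   | yes _   = refl
  ... | no i≮n  | _       = contradiction i<n i≮n
  ... | yes _   | no j≮n  = contradiction j<n j≮n

  extend-support : ∀ i j → extend i j ≡ true → toℕ i < n × toℕ j < n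
  extend-support i j e with toℕ i <? n | toℕ j <? n
  ... | yes i<n | yes j<n = i<n , j<n

  occurs-extend : ∀ {k} (π : Permutation′ k) → Occurs π extend → Occurs π M
  occurs-extend π (f , g , f↑ , g↑ , hit) =
    (λ i → fromℕ< (f< i)) , (λ j → fromℕ< (g< j)) ,
    (λ i j i<j → subst₂ _<_ (sym (Fin.toℕ-fromℕ< (f< i))) (sym (Fin.toℕ-fromℕ< (f< j))) (f↑ i j i<j)) ,
    (λ i j i<j → subst₂ _<_ (sym (Fin.toℕ-fromℕ< (g< i))) (sym (Fin.toℕ-fromℕ< (g< j))) (g↑ i j i<j)) ,
    λ i → trans (sym (extend-inside (f i) (g (π ⟨$⟩ʳ i)) (f< i) (g< _))) (hit i)
    where
    f< : ∀ i → toℕ (f i) < n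
    f< i = proj₁ (extend-support _ _ (hit i))
    g< : ∀ j → toℕ (g j) < n
    g< j = subst (λ z → toℕ (g z) < n) (inverseʳ π) (proj₂ (extend-support _ _ (hit (π ⟨$⟩ˡ j))))

extend-inject≤ : ∀ {n N} (M : BMat n) (n≤N : n ≤ N) i j → extend M (inject≤ i n≤N) (inject≤ j n≤N) ≡ M i j
extend-inject≤ {n} M n≤N i j =
  trans (extend-inside M _ _ (below i) (below j)) (cong₂ M (back i) (back j))
  where
  below : ∀ i → toℕ (inject≤ i n≤N) < n
  below i = subst (_< n) (sym (Fin.toℕ-inject≤ i n≤N)) (Fin.toℕ<n i)
  back : ∀ i → fromℕ< (below i) ≡ i
  back i = trans (Fin.fromℕ<-cong _ _ (Fin.toℕ-inject≤ i n≤N) (below i) (Fin.toℕ<n i)) (Fin.fromℕ<-toℕ i (Fin.toℕ<n i))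

-- Rounding up to a power of `s` costs at most a factor `s`, so the code stays exponential in the
-- original size. In the induction, the exponent grows exactly when the old size equals the power.
size-between : ∀ s → 2 ≤ s → ∀ n → ∃ λ t → suc n ≤ size s t × size s t ≤ suc n * s
size-between s 2≤s zero = 0 , ℕ.≤-refl , ℕ.≤-trans (ℕ.≤-trans (s≤s z≤n) 2≤s) (ℕ.m≤m+n s 0)
size-between s 2≤s (suc n) with size-between s 2≤s n
... | t , n≤N , N≤ns with ℕ.m≤n⇒m<n∨m≡n n≤N
...   | inj₁ n<N = t , n<N , ℕ.≤-trans N≤ns (ℕ.m≤n+m _ s)
...   | inj₂ n≡N = suc t , below , ℕ.≤-trans (ℕ.≤-reflexive (cong (_* s) (sym n≡N))) (ℕ.m≤n+m _ s)
  where
  open ℕ.≤-Reasoning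
  below : suc (suc n) ≤ size s t * s
  below = begin
    suc (suc n)        ≤⟨ s≤s (ℕ.m≤n+m _ n) ⟩
    suc n + suc n      ≡⟨ cong (λ z → suc n + z) (ℕ.+-identityʳ (suc n)) ⟨
    2 * suc n          ≡⟨ ℕ.*-comm 2 (suc n) ⟩
    suc n * 2          ≤⟨ ℕ.*-mono-≤ n≤N 2≤s ⟩
    size s t * s       ∎

coding : ∀ {m} (π : Permutation′ (suc m)) → Σ ℕ λ c → ∀ n → Coding π n (c ^ n)
coding {m} π = B ^ s , λ where
    zero    → record { code = λ _ → zero ; code-injective = λ _ _ _ _ _ () }
    (suc n) → extended n (size-between s 2≤s n)
  where
  -- Large enough for both `m * m < s` and `2 ≤ s`.
  s = suc (suc (m * m))
  B = base s m
  2≤s : 2 ≤ s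
  2≤s = s≤s (s≤s z≤n)
  instance
    _ = ℕ.m^n≢0 2 (s * s)
    _ = ℕ.m^n≢0 (2 ^ (s * s)) (suc (density s m))
    _ = ℕ.m*n≢0 2 ((2 ^ (s * s)) ^ suc (density s m))
  extended : ∀ n → (∃ λ t → suc n ≤ size s t × size s t ≤ suc n * s) → Coding π (suc n) ((B ^ s) ^ suc n)
  extended n (t , n≤N , N≤ns) = widen bound record
    { code           = λ M → code big (extend M)
    ; code-injective = λ M W avM avW eq i j → trans (sym (extend-inject≤ M n≤N i j))
        (trans (code-injective big (extend M) (extend W)
                 (avM ∘ occurs-extend M π) (avW ∘ occurs-extend W π) eq (inject≤ i n≤N) (inject≤ j n≤N))
               (extend-inject≤ W n≤N i j))
    }
    where
    big = size-coding s (s≤s (ℕ.n≤1+n _)) 2≤s π t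
    bound : B ^ size s t ≤ (B ^ s) ^ suc n
    bound = ℕ.≤-trans (ℕ.^-monoʳ-≤ B N≤ns)
      (ℕ.≤-reflexive (trans (cong (B ^_) (ℕ.*-comm (suc n) s)) (sym (ℕ.^-*-assoc B s (suc n)))))

-- Signs along an alternating line

Sign : ℤ → Set
Sign x = x ≡ + 1 ⊎ x ≡ -[1+ 0 ]

sign≢0 : ∀ {x} → Sign x → x ≢ + 0
sign≢0 (inj₁ refl) ()
sign≢0 (inj₂ refl) ()

sign-cancel : ∀ {x y} → Sign x → Sign y → x ≢ y → x ℤ.+ y ≡ + 0
sign-cancel (inj₁ refl) (inj₁ refl) x≢y = contradiction refl x≢y
sign-cancel (inj₁ refl) (inj₂ refl) x≢y = refl
sign-cancel (inj₂ refl) (inj₁ refl) x≢y = refl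
sign-cancel (inj₂ refl) (inj₂ refl) x≢y = contradiction refl x≢y

≢-≢⇒≡ : ∀ {x y z} → Sign x → Sign y → Sign z → x ≢ y → y ≢ z → x ≡ z
≢-≢⇒≡ (inj₁ refl) _           (inj₁ refl) _   _   = refl
≢-≢⇒≡ (inj₂ refl) _           (inj₂ refl) _   _   = refl
≢-≢⇒≡ (inj₁ refl) (inj₁ refl) (inj₂ refl) x≢y _   = contradiction refl x≢y
≢-≢⇒≡ (inj₁ refl) (inj₂ refl) (inj₂ refl) _   y≢z = contradiction refl y≢z
≢-≢⇒≡ (inj₂ refl) (inj₁ refl) (inj₁ refl) _   y≢z = contradiction refl y≢z
≢-≢⇒≡ (inj₂ refl) (inj₂ refl) (inj₁ refl) x≢y _   = contradiction refl x≢y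

-- Only the first and last nonzero positions `p` and `q` are recorded: by alternation their signs
-- determine the sum, and this much information survives prepending an entry.
data Shape {n} (v : Fin n → ℤ) : Set where
  blank : (∀ i → v i ≡ + 0) → Σℤ v ≡ + 0 → Shape v
  span  : ∀ p q → Sign (v p) → Sign (v q) →
          (∀ i → i <ᶠ p → v i ≡ + 0) → (∀ i → q <ᶠ i → v i ≡ + 0) →
          (v p ≡ v q × Σℤ v ≡ v p) ⊎ (v p ≢ v q × Σℤ v ≡ + 0) → Shape v

alternating-tail : ∀ {n} {v : Fin (suc n) → ℤ} → Alternating v → Alternating (v ∘ suc)
alternating-tail alt j j′ j<j′ vj vj′ between =
  alt (suc j) (suc j′) (s≤s j<j′) vj vj′ λ where
    zero    ()
    (suc l) (s≤s j<l) (s≤s l<j′) → between l j<l l<j′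

shape : ∀ {n} (v : Fin n → ℤ) → (∀ i → Entry (v i)) → Alternating v → Shape v
shape {zero}  v entry alt = blank (λ ()) refl
shape {suc n} v entry alt with entry zero | shape (v ∘ suc) (entry ∘ suc) (alternating-tail alt)
... | inj₁ v0≡0 | blank zeros total =
  blank (λ { zero → v0≡0 ; (suc i) → zeros i }) (cong₂ ℤ._+_ v0≡0 total)
... | inj₁ v0≡0 | span p q vp vq before after total =
  span (suc p) (suc q) vp vq
    (λ { zero _ → v0≡0 ; (suc i) (s≤s i<p) → before i i<p })
    (λ { (suc i) (s≤s q<i) → after i q<i })
    (map (λ (e , t) → e , trans skip t) (λ (e , t) → e , trans skip t) total)
  where
  skip : Σℤ v ≡ Σℤ (v ∘ suc)
  skip = trans (cong (ℤ._+ Σℤ (v ∘ suc)) v0≡0) (ℤ.+-identityˡ _)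
... | inj₂ v0 | blank zeros total =
  span zero zero v0 v0 (λ _ ()) (λ { (suc i) _ → zeros i })
    (inj₁ (refl , trans (cong (λ z → v zero ℤ.+ z) total) (ℤ.+-identityʳ _)))
... | inj₂ v0 | span p q vp vq before after total =
  span zero (suc q) v0 vq (λ _ ()) (λ { (suc i) (s≤s q<i) → after i q<i }) (combined total)
  where
  v0≢vp : v zero ≢ v (suc p)
  v0≢vp = alt zero (suc p) (s≤s z≤n) (sign≢0 v0) (sign≢0 vp) λ { (suc l) _ (s≤s l<p) → before l l<p }
  -- The new first sign is opposite to the old one, so the cases of equal and of different end signs
  -- are exchanged.
  combined : (v (suc p) ≡ v (suc q) × Σℤ (v ∘ suc) ≡ v (suc p)) ⊎ (v (suc p) ≢ v (suc q) × Σℤ (v ∘ suc) ≡ + 0) →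
    (v zero ≡ v (suc q) × Σℤ v ≡ v zero) ⊎ (v zero ≢ v (suc q) × Σℤ v ≡ + 0)
  combined (inj₁ (vp≡vq , t)) = inj₂ ((λ e → v0≢vp (trans e (sym vp≡vq))) ,
    trans (cong (λ z → v zero ℤ.+ z) t) (sign-cancel v0 vp v0≢vp))
  combined (inj₂ (vp≢vq , t)) = inj₁ (≢-≢⇒≡ v0 vp vq v0≢vp vp≢vq ,
    trans (cong (λ z → v zero ℤ.+ z) t) (ℤ.+-identityʳ _))

-- Sum 1 forces the first and last nonzero entries both to be 1; a -1 is nonzero and different from
-- them, hence strictly between.
surrounded : ∀ {n} (v : Fin n → ℤ) → (∀ i → Entry (v i)) → Σℤ v ≡ + 1 → Alternating v →
  ∀ j → v j ≡ -[1+ 0 ] → (∃ λ p → p <ᶠ j × v p ≡ + 1) × (∃ λ q → j <ᶠ q × v q ≡ + 1)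
surrounded v entry total alt j vj with shape v entry alt
... | blank _ t with () ← trans (sym total) t
... | span p q vp vq before after (inj₂ (_ , t)) with () ← trans (sym total) t
... | span p q vp vq before after (inj₁ (vp≡vq , t)) =
  (p , p<j , vp≡1) , (q , j<q , vq≡1)
  where
  vp≡1 = trans (sym t) total
  vq≡1 = trans (sym vp≡vq) vp≡1
  differs : ∀ {i} → v i ≡ + 1 → i ≢ j
  differs vi refl with () ← trans (sym vi) vj
  vj≢0 : v j ≢ + 0
  vj≢0 e with () ← trans (sym vj) e
  p<j = Fin.≤∧≢⇒< (ℕ.≮⇒≥ (vj≢0 ∘ before j)) (differs vp≡1)
  j<q = Fin.≤∧≢⇒< (ℕ.≮⇒≥ (vj≢0 ∘ after j)) (differs vq≡1 ∘ sym)

-- Outer patterns and minus ones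

Extreme : ∀ {k} → Fin k → Set
Extreme {k} i = toℕ i ≡ 0 ⊎ suc (toℕ i) ≡ k

Outer : ∀ {k} → Permutation′ k → Set
Outer σ = ∀ i → Extreme i ⊎ Extreme (σ ⟨$⟩ʳ i)

extreme? : ∀ {k} (i : Fin k) → Dec (Extreme i)
extreme? {k} i = (toℕ i ℕ.≟ 0) ⊎-dec (suc (toℕ i) ℕ.≟ k)

module _ {k n : ℕ} (f : Fin k → Fin n) (low high : Fin k → Fin n) where

  stretch : Fin k → Fin n
  stretch i with toℕ i ℕ.≟ 0 | suc (toℕ i) ℕ.≟ k
  ... | yes _ | _     = low i
  ... | no _  | yes _ = high i
  ... | no _  | no _  = f i

  -- For `i < j`, index `i` is not last and can only move down, while `j` is not first and can only
  -- move up.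
  stretch-increasing : (∀ i → low i Fin.≤ f i) → (∀ i → f i Fin.≤ high i) → Increasing f → Increasing stretch
  stretch-increasing low≤ ≤high f↑ i j i<j = ℕ.≤-<-trans stretch≤ (ℕ.<-≤-trans (f↑ i j i<j) ≤stretch)
    where
    stretch≤ : toℕ (stretch i) ≤ toℕ (f i)
    stretch≤ with toℕ i ℕ.≟ 0 | suc (toℕ i) ℕ.≟ k
    ... | yes _ | _        = low≤ i
    ... | no _  | yes last = contradiction (ℕ.≤-trans (s≤s i<j) (Fin.toℕ<n j)) (ℕ.<-irrefl last)
    ... | no _  | no _     = ℕ.≤-refl
    ≤stretch : toℕ (f j) ≤ toℕ (stretch j)
    ≤stretch with toℕ j ℕ.≟ 0 | suc (toℕ j) ℕ.≟ k
    ... | yes first | _     = contradiction (subst (toℕ i <_) first i<j) λ ()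
    ... | no _      | yes _ = ≤high j
    ... | no _      | no _  = ℕ.≤-refl

  stretch-cases : (P : Fin k → Fin n → Set) → (∀ i → P i (low i)) → (∀ i → P i (high i)) →
    ∀ i → Extreme i → P i (stretch i)
  stretch-cases P pl ph i outer with toℕ i ℕ.≟ 0 | suc (toℕ i) ℕ.≟ k
  ... | yes _ | _     = pl i
  ... | no _  | yes _ = ph i
  stretch-cases P pl ph i (inj₁ e) | no ne | no _ = contradiction e ne
  stretch-cases P pl ph i (inj₂ e) | no _ | no ne = contradiction e ne

  stretch-inner : ∀ i → ¬ Extreme i → stretch i ≡ f i
  stretch-inner i inner with toℕ i ℕ.≟ 0 | suc (toℕ i) ℕ.≟ k
  ... | yes e | _     = contradiction (inj₁ e) inner
  ... | no _  | yes e = contradiction (inj₂ e) inner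
  ... | no _  | no _  = refl

level : ∀ {n} → ℤ → Matrix n → BMat n
level x A i j = does (A i j ℤ.≟ x)

contains-positive : ∀ {n k} (π : Permutation′ k) (A : Matrix n) → Occurs π (level (+ 1) A) → Contains A π
contains-positive π A (f , g , f↑ , g↑ , hit) = f , g , f↑ , g↑ , λ i → does-true (A _ _ ℤ.≟ + 1) (hit i)

pick : ∀ {E A : Set} → Dec E → A → A → A
pick (yes _) x y = x
pick (no _)  x y = y

pick-elim : ∀ {E A : Set} (E? : Dec E) {x y : A} (P : A → Set) → (E → P x) → (¬ E → P y) → P (pick E? x y)
pick-elim (yes e) P px py = px e
pick-elim (no ¬e) P px py = py ¬e

-- A -1 in the pattern's first or last row (column) is replaced by the 1 beyond it in the same
-- column (row); the order of the rows and columns involved is unchanged.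
contains-negative : ∀ {n k} (π : Permutation′ k) → Outer π → (A : Matrix n) → IsASM A →
  Occurs π (level -[1+ 0 ] A) → Contains A π
contains-negative {n} {k} π outer A (entry , rowSum , columnSum , rowAlt , columnAlt) (f , g , f↑ , g↑ , hit) =
  f′ , g′ ,
  stretch-increasing f above below
    (λ i → ℕ.<⇒≤ (proj₁ (proj₂ (proj₁ (vertical i)))))
    (λ i → ℕ.<⇒≤ (proj₁ (proj₂ (proj₂ (vertical i))))) f↑ ,
  stretch-increasing g left right
    (λ j → pick-elim (extremeRow? j) (Fin._≤ g j) (λ _ → ℕ.≤-refl)
      (λ _ → ℕ.<⇒≤ (proj₁ (proj₂ (proj₁ (horizontal j))))))
    (λ j → pick-elim (extremeRow? j) (g j Fin.≤_) (λ _ → ℕ.≤-refl)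
      (λ _ → ℕ.<⇒≤ (proj₁ (proj₂ (proj₂ (horizontal j)))))) g↑ ,
  positive
  where
  negative : ∀ i → A (f i) (g (π ⟨$⟩ʳ i)) ≡ -[1+ 0 ]
  negative i = does-true (A _ _ ℤ.≟ -[1+ 0 ]) (hit i)
  negative⁻¹ : ∀ j → A (f (π ⟨$⟩ˡ j)) (g j) ≡ -[1+ 0 ]
  negative⁻¹ j = subst (λ z → A (f (π ⟨$⟩ˡ j)) (g z) ≡ -[1+ 0 ]) (inverseʳ π) (negative (π ⟨$⟩ˡ j))
  vertical : ∀ i → _
  vertical i = surrounded (λ r → A r (g (π ⟨$⟩ʳ i))) (λ r → entry r _) (columnSum _) (columnAlt _) (f i) (negative i)
  horizontal : ∀ j → _
  horizontal j = surrounded (A (f (π ⟨$⟩ˡ j))) (entry _) (rowSum _) (rowAlt _) (g j) (negative⁻¹ j)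
  above = λ i → proj₁ (proj₁ (vertical i))
  below = λ i → proj₁ (proj₂ (vertical i))
  extremeRow? = λ j → extreme? (π ⟨$⟩ˡ j)
  -- A point in an extreme row moves vertically, so its column has to stay; only points in inner
  -- rows move horizontally. In particular a corner point moves once.
  left right : Fin k → Fin n
  left  j = pick (extremeRow? j) (g j) (proj₁ (proj₁ (horizontal j)))
  right j = pick (extremeRow? j) (g j) (proj₁ (proj₂ (horizontal j)))
  f′ = stretch f above below
  g′ = stretch g left right

  g′-fixed : ∀ j → Extreme (π ⟨$⟩ˡ j) → g′ j ≡ g j
  g′-fixed j e with extreme? j
  ... | yes j-extreme = stretch-cases g left right (λ j c → Extreme (π ⟨$⟩ˡ j) → c ≡ g j)
    (λ j e → pick-elim (extremeRow? j) (_≡ g j) (λ _ → refl) (contradiction e))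
    (λ j e → pick-elim (extremeRow? j) (_≡ g j) (λ _ → refl) (contradiction e)) j j-extreme e
  ... | no j-inner = stretch-inner g left right j j-inner

  -- Each pattern row and column carries one point, so moving a line affects that point alone:
  -- extreme rows use the vertical 1, and for inner rows `outer` provides an extreme column and the
  -- horizontal 1.
  positive : ∀ i → A (f′ i) (g′ (π ⟨$⟩ʳ i)) ≡ + 1
  positive i with extreme? i | outer i
  ... | yes e | _ = trans (cong (A (f′ i)) (g′-fixed (π ⟨$⟩ʳ i) (subst Extreme (sym (inverseˡ π)) e)))
    (stretch-cases f above below (λ i r → A r (g (π ⟨$⟩ʳ i)) ≡ + 1)
      (λ i → proj₂ (proj₂ (proj₁ (vertical i)))) (λ i → proj₂ (proj₂ (proj₂ (vertical i)))) i e)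
  ... | no inner | inj₁ e = contradiction e inner
  ... | no inner | inj₂ e = trans (cong (λ r → A r (g′ (π ⟨$⟩ʳ i)))
      (trans (stretch-inner f above below i inner) (cong f (sym (inverseˡ π)))))
    (stretch-cases g left right (λ j c → ¬ Extreme (π ⟨$⟩ˡ j) → A (f (π ⟨$⟩ˡ j)) c ≡ + 1)
      (λ j ne → pick-elim (extremeRow? j) (λ c → A (f (π ⟨$⟩ˡ j)) c ≡ + 1)
        (λ e → contradiction e ne) (λ _ → proj₂ (proj₂ (proj₁ (horizontal j)))))
      (λ j ne → pick-elim (extremeRow? j) (λ c → A (f (π ⟨$⟩ˡ j)) c ≡ + 1)
        (λ e → contradiction e ne) (λ _ → proj₂ (proj₂ (proj₂ (horizontal j)))))
      (π ⟨$⟩ʳ i) e (subst (λ z → ¬ Extreme z) (sym (inverseˡ π)) inner))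

levels-determine : ∀ {n} (A B : Matrix n) → (∀ i j → Entry (A i j)) → (∀ i j → Entry (B i j)) →
  (∀ i j → level (+ 1) A i j ≡ level (+ 1) B i j) →
  (∀ i j → level -[1+ 0 ] A i j ≡ level -[1+ 0 ] B i j) → ∀ i j → A i j ≡ B i j
levels-determine A B entryA entryB pos neg i j = same (entryA i j) (entryB i j) (pos i j) (neg i j)
  where
  same : ∀ {x y} → Entry x → Entry y →
    does (x ℤ.≟ + 1) ≡ does (y ℤ.≟ + 1) → does (x ℤ.≟ -[1+ 0 ]) ≡ does (y ℤ.≟ -[1+ 0 ]) → x ≡ y
  same (inj₁ refl)        (inj₁ refl)        _ _ = refl
  same (inj₂ (inj₁ refl)) (inj₂ (inj₁ refl)) _ _ = refl
  same (inj₂ (inj₂ refl)) (inj₂ (inj₂ refl)) _ _ = refl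
  same (inj₁ refl)        (inj₂ (inj₁ refl)) () _
  same (inj₁ refl)        (inj₂ (inj₂ refl)) _ ()
  same (inj₂ (inj₁ refl)) (inj₁ refl)        () _
  same (inj₂ (inj₁ refl)) (inj₂ (inj₂ refl)) () _
  same (inj₂ (inj₂ refl)) (inj₁ refl)        _ ()
  same (inj₂ (inj₂ refl)) (inj₂ (inj₁ refl)) () _

-- The positions of the 1s and of the -1s are coded separately with the same base `b`, whence the
-- constant `b ^ 2`.
upper-bound : ∀ {m} (σ : Permutation′ (suc m)) → Outer σ → Σ ℕ λ c → ∀ n → CardLe n σ (c ^ n)
upper-bound {m} σ outer = b ^ 2 , λ n → subst (CardLe n σ) (square n) (injection n)
  where
  b = proj₁ (coding σ)
  square : ∀ n → b ^ n * b ^ n ≡ (b ^ 2) ^ n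
  square n = trans (sym (ℕ.^-distribˡ-+-* b n n))
    (trans (cong (λ z → b ^ (n + z)) (sym (ℕ.+-identityʳ n))) (sym (ℕ.^-*-assoc b 2 n)))
  injection : ∀ n → CardLe n σ (b ^ n * b ^ n)
  injection n = (λ (A , _) → combine (code c (level (+ 1) A)) (code c (level -[1+ 0 ] A))) , injective
    where
    c = proj₂ (coding σ) n
    injective : (x y : ASMAvoiding n σ) → _ → SameMatrix {σ = σ} x y
    injective (A , asmA , avA) (B , asmB , avB) eq =
      levels-determine A B (proj₁ asmA) (proj₁ asmB)
        (code-injective c (level (+ 1) A) (level (+ 1) B)
          (avA ∘ contains-positive σ A) (avB ∘ contains-positive σ B) (proj₁ parts))
        (code-injective c (level -[1+ 0 ] A) (level -[1+ 0 ] B)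
          (avA ∘ contains-negative σ outer A asmA) (avB ∘ contains-negative σ outer B asmB) (proj₂ parts))
      where
      parts = Fin.combine-injective (code c (level (+ 1) A)) (code c (level -[1+ 0 ] A))
                                    (code c (level (+ 1) B)) (code c (level -[1+ 0 ] B)) eq

-- The class X

⟨$⟩ʳ-injective : ∀ {k} (σ : Permutation′ k) {i j} → σ ⟨$⟩ʳ i ≡ σ ⟨$⟩ʳ j → i ≡ j
⟨$⟩ʳ-injective σ = Injection.injective (↔⇒↣ σ)

letter : ∀ {k} → Fin k → ℕ
letter a = suc (toℕ a)

∈X₂ : ∀ (a b : Fin 2) → a ≢ b → (letter a ∷ letter b ∷ []) ∈ X
∈X₂ = toWitness {a? = Fin.all? λ a → Fin.all? λ b → ¬? (a Fin.≟ b) →-dec (_ ∈? X)} _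

-- A finite check over all words of values. The first and last letters sit at extreme indices, so
-- only the middle letter is constrained; distinctness of the letters restricts the converse to
-- permutations.
∈X₃⇔extreme : ∀ (a b c : Fin 3) →
  ((letter a ∷ letter b ∷ letter c ∷ []) ∈ X → Extreme b) ×
  (a ≢ b × a ≢ c × b ≢ c → Extreme b → (letter a ∷ letter b ∷ letter c ∷ []) ∈ X)
∈X₃⇔extreme = toWitness {a? = Fin.all? λ a → Fin.all? λ b → Fin.all? λ c →
  ((_ ∈? X) →-dec extreme? b) ×-dec
  ((¬? (a Fin.≟ b) ×-dec ¬? (a Fin.≟ c) ×-dec ¬? (b Fin.≟ c)) →-dec (extreme? b →-dec (_ ∈? X)))} _

∈X₄⇔extreme : ∀ (a b c d : Fin 4) →
  ((letter a ∷ letter b ∷ letter c ∷ letter d ∷ []) ∈ X → Extreme b × Extreme c) ×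
  (a ≢ b × a ≢ c × a ≢ d × b ≢ c × b ≢ d × c ≢ d → Extreme b × Extreme c →
    (letter a ∷ letter b ∷ letter c ∷ letter d ∷ []) ∈ X)
∈X₄⇔extreme = toWitness {a? = Fin.all? λ a → Fin.all? λ b → Fin.all? λ c → Fin.all? λ d →
  ((_ ∈? X) →-dec (extreme? b ×-dec extreme? c)) ×-dec
  ((¬? (a Fin.≟ b) ×-dec ¬? (a Fin.≟ c) ×-dec ¬? (a Fin.≟ d) ×-dec
    ¬? (b Fin.≟ c) ×-dec ¬? (b Fin.≟ d) ×-dec ¬? (c Fin.≟ d)) →-dec
   ((extreme? b ×-dec extreme? c) →-dec (_ ∈? X)))} _

X-short : All (λ l → length l ≤ 4) X
X-short = toWitness {a? = all? (λ l → length l ℕ.≤? 4) X} _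

length-oneLine : ∀ {k} (σ : Permutation′ k) → length (oneLine σ) ≡ k
length-oneLine {k} σ = trans (length-map (λ i → letter (σ ⟨$⟩ʳ i)) (allFin k)) (length-tabulate {n = k} (λ i → i))

InX⇒Outer : ∀ {k} (σ : Permutation′ k) → InX σ → Outer σ
InX⇒Outer {1} σ inX 0F = inj₁ (inj₁ refl)
InX⇒Outer {2} σ inX 0F = inj₁ (inj₁ refl)
InX⇒Outer {2} σ inX 1F = inj₁ (inj₂ refl)
InX⇒Outer {3} σ inX 0F = inj₁ (inj₁ refl)
InX⇒Outer {3} σ inX 1F = inj₂ (proj₁ (∈X₃⇔extreme (σ ⟨$⟩ʳ 0F) (σ ⟨$⟩ʳ 1F) (σ ⟨$⟩ʳ 2F)) inX)
InX⇒Outer {3} σ inX 2F = inj₁ (inj₂ refl)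
InX⇒Outer {4} σ inX 0F = inj₁ (inj₁ refl)
InX⇒Outer {4} σ inX 1F = inj₂ (proj₁ (proj₁ (∈X₄⇔extreme (σ ⟨$⟩ʳ 0F) (σ ⟨$⟩ʳ 1F) (σ ⟨$⟩ʳ 2F) (σ ⟨$⟩ʳ 3F)) inX))
InX⇒Outer {4} σ inX 2F = inj₂ (proj₂ (proj₁ (∈X₄⇔extreme (σ ⟨$⟩ʳ 0F) (σ ⟨$⟩ʳ 1F) (σ ⟨$⟩ʳ 2F) (σ ⟨$⟩ʳ 3F)) inX))
InX⇒Outer {4} σ inX 3F = inj₁ (inj₂ refl)
InX⇒Outer {suc (suc (suc (suc (suc k))))} σ inX =
  contradiction (subst (_≤ 4) (length-oneLine σ) (lookup X-short inX)) λ { (s≤s (s≤s (s≤s (s≤s ())))) }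

same-extreme : ∀ {k} (a b c : Fin k) → Extreme a → Extreme b → Extreme c → a ≡ b ⊎ a ≡ c ⊎ b ≡ c
same-extreme a b c (inj₁ p) (inj₁ q) _        = inj₁ (Fin.toℕ-injective (trans p (sym q)))
same-extreme a b c (inj₂ p) (inj₂ q) _        = inj₁ (Fin.toℕ-injective (ℕ.suc-injective (trans p (sym q))))
same-extreme a b c (inj₁ p) (inj₂ q) (inj₁ r) = inj₂ (inj₁ (Fin.toℕ-injective (trans p (sym r))))
same-extreme a b c (inj₁ p) (inj₂ q) (inj₂ r) = inj₂ (inj₂ (Fin.toℕ-injective (ℕ.suc-injective (trans q (sym r)))))
same-extreme a b c (inj₂ p) (inj₁ q) (inj₁ r) = inj₂ (inj₂ (Fin.toℕ-injective (trans q (sym r))))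
same-extreme a b c (inj₂ p) (inj₁ q) (inj₂ r) = inj₂ (inj₁ (Fin.toℕ-injective (ℕ.suc-injective (trans p (sym r)))))

-- From length 5 on, the indices 1, 2 and 3 are all inner, so their three distinct values would have
-- to share the two extreme columns. Shorter lengths are finite checks.
Outer⇒InX : ∀ {k} → 1 ≤ k → (σ : Permutation′ k) → Outer σ → InX σ
Outer⇒InX {1} _ σ outer with σ ⟨$⟩ʳ 0F
... | 0F = here refl
Outer⇒InX {2} _ σ outer = ∈X₂ (σ ⟨$⟩ʳ 0F) (σ ⟨$⟩ʳ 1F) λ e → contradiction (⟨$⟩ʳ-injective σ e) λ ()
Outer⇒InX {3} _ σ outer with outer 1F
... | inj₁ (inj₁ ())
... | inj₁ (inj₂ ())
... | inj₂ e = proj₂ (∈X₃⇔extreme (σ ⟨$⟩ʳ 0F) (σ ⟨$⟩ʳ 1F) (σ ⟨$⟩ʳ 2F))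
  ((λ e → contradiction (⟨$⟩ʳ-injective σ e) λ ()) ,
   (λ e → contradiction (⟨$⟩ʳ-injective σ e) λ ()) ,
   (λ e → contradiction (⟨$⟩ʳ-injective σ e) λ ())) e
Outer⇒InX {4} _ σ outer with outer 1F | outer 2F
... | inj₁ (inj₁ ()) | _
... | inj₁ (inj₂ ()) | _
... | inj₂ _ | inj₁ (inj₁ ())
... | inj₂ _ | inj₁ (inj₂ ())
... | inj₂ e | inj₂ e′ = proj₂ (∈X₄⇔extreme (σ ⟨$⟩ʳ 0F) (σ ⟨$⟩ʳ 1F) (σ ⟨$⟩ʳ 2F) (σ ⟨$⟩ʳ 3F))
  ((λ e → contradiction (⟨$⟩ʳ-injective σ e) λ ()) ,
   (λ e → contradiction (⟨$⟩ʳ-injective σ e) λ ()) ,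
   (λ e → contradiction (⟨$⟩ʳ-injective σ e) λ ()) ,
   (λ e → contradiction (⟨$⟩ʳ-injective σ e) λ ()) ,
   (λ e → contradiction (⟨$⟩ʳ-injective σ e) λ ()) ,
   (λ e → contradiction (⟨$⟩ʳ-injective σ e) λ ())) (e , e′)
Outer⇒InX {suc (suc (suc (suc (suc k))))} _ σ outer
  with same-extreme _ _ _ (column 1F (λ ()) (λ ())) (column 2F (λ ()) (λ ())) (column 3F (λ ()) (λ ()))
  where
  column : ∀ i → toℕ i ≢ 0 → suc (toℕ i) ≢ 5 + k → Extreme (σ ⟨$⟩ʳ i)
  column i ≢0 ≢k with outer i
  ... | inj₁ (inj₁ e) = contradiction e ≢0
  ... | inj₁ (inj₂ e) = contradiction e ≢k
  ... | inj₂ e        = e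
... | inj₁ e        = contradiction (⟨$⟩ʳ-injective σ e) λ ()
... | inj₂ (inj₁ e) = contradiction (⟨$⟩ʳ-injective σ e) λ ()
... | inj₂ (inj₂ e) = contradiction (⟨$⟩ʳ-injective σ e) λ ()

-- Monotone triples through an inner point

MonotoneTriple : ∀ {k} → (ℕ → ℕ → Set) → Permutation′ k → Set
MonotoneTriple _≺_ σ = ∃ λ i → ∃ λ j → ∃ λ l → i <ᶠ j × j <ᶠ l ×
  (toℕ (σ ⟨$⟩ʳ i) ≺ toℕ (σ ⟨$⟩ʳ j)) × (toℕ (σ ⟨$⟩ʳ j) ≺ toℕ (σ ⟨$⟩ʳ l))

-- Each side of an inner point i carries another point, lying in one of the four open quadrants
-- around it; two of these points lie in opposite quadrants.
inner⇒triple : ∀ {k} (σ : Permutation′ k) i → ¬ Extreme i → ¬ Extreme (σ ⟨$⟩ʳ i) →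
  MonotoneTriple _<_ σ ⊎ MonotoneTriple (λ a b → b < a) σ
inner⇒triple {suc k} σ i inner inner′ = cases
  where
  value : Fin (suc k) → ℕ
  value j = toℕ (σ ⟨$⟩ʳ j)
  last = fromℕ k
  0<i : zero {k} <ᶠ i
  0<i = ℕ.n≢0⇒n>0 (inner ∘ inj₁)
  <last : (j : Fin (suc k)) → suc (toℕ j) ≢ suc k → toℕ j < k
  <last j ne = ℕ.≤∧≢⇒< (ℕ.≤-pred (Fin.toℕ<n j)) (ne ∘ cong suc)
  i<last : i <ᶠ last
  i<last = subst (toℕ i <_) (sym (Fin.toℕ-fromℕ k)) (<last i (inner ∘ inj₂))
  leftmost  = σ ⟨$⟩ˡ zero
  rightmost = σ ⟨$⟩ˡ last
  leftmost< : value leftmost < value i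
  leftmost< = subst (λ z → toℕ z < value i) (sym (inverseʳ σ)) (ℕ.n≢0⇒n>0 (inner′ ∘ inj₁))
  <rightmost : value i < value rightmost
  <rightmost = subst (λ z → value i < toℕ z) (sym (inverseʳ σ))
    (subst (value i <_) (sym (Fin.toℕ-fromℕ k)) (<last (σ ⟨$⟩ʳ i) (inner′ ∘ inj₂)))
  distinct : ∀ {j} → value j ≡ value i → j ≡ i
  distinct e = ⟨$⟩ʳ-injective σ (Fin.toℕ-injective e)
  cases : MonotoneTriple _<_ σ ⊎ MonotoneTriple (λ a b → b < a) σ
  cases with ℕ.<-cmp (value zero) (value i) | ℕ.<-cmp (value last) (value i)
  ... | tri≈ _ e _ | _ = contradiction 0<i (Fin.<-irrefl (distinct e))
  ... | tri< _ _ _ | tri≈ _ e _ = contradiction i<last (Fin.<-irrefl (sym (distinct e)))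
  ... | tri> _ _ _ | tri≈ _ e _ = contradiction i<last (Fin.<-irrefl (sym (distinct e)))
  ... | tri< nw _ _ | tri> _ _ se = inj₁ (zero , i , last , 0<i , i<last , nw , se)
  ... | tri> _ _ ne | tri< sw _ _ = inj₂ (zero , i , last , 0<i , i<last , ne , sw)
  -- The first and last rows both have their points to the left. The point in the last column is to
  -- the right, hence opposite to one of them; the case of both to the right is symmetric.
  ... | tri< nw _ _ | tri< sw _ _ with Fin.<-cmp rightmost i
  ...   | tri< c<i _ _ = inj₂ (rightmost , i , last , c<i , i<last , <rightmost , sw)
  ...   | tri≈ _ e _   = contradiction (subst (λ z → value i < value z) e <rightmost) (ℕ.<-irrefl refl)
  ...   | tri> _ _ i<c = inj₁ (zero , i , rightmost , 0<i , i<c , nw , <rightmost)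
  cases | tri> _ _ ne | tri> _ _ se with Fin.<-cmp leftmost i
  ...   | tri< c<i _ _ = inj₁ (leftmost , i , last , c<i , i<last , leftmost< , se)
  ...   | tri≈ _ e _   = contradiction (subst (λ z → value z < value i) e leftmost<) (ℕ.<-irrefl refl)
  ...   | tri> _ _ i<c = inj₂ (zero , i , leftmost , 0<i , i<c , ne , leftmost<)

∉X⇒triple : ∀ {k} → 1 ≤ k → (σ : Permutation′ k) → ¬ InX σ →
  MonotoneTriple _<_ σ ⊎ MonotoneTriple (λ a b → b < a) σ
∉X⇒triple 1≤k σ ∉X with Fin.any? (λ i → ¬? (extreme? i) ×-dec ¬? (extreme? (σ ⟨$⟩ʳ i)))
... | yes (i , inner , inner′) = inner⇒triple σ i inner inner′
... | no none = contradiction (Outer⇒InX 1≤k σ outer) ∉X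
  where
  outer : Outer σ
  outer i with extreme? i | extreme? (σ ⟨$⟩ʳ i)
  ... | yes e | _     = inj₁ e
  ... | no _  | yes e = inj₂ e
  ... | no ¬e | no ¬e′ = contradiction (i , ¬e , ¬e′) none

-- Many matrices without a decreasing triple

Σ-zero : ∀ {n} {v : Fin n → ℤ} → (∀ i → v i ≡ + 0) → Σℤ v ≡ + 0
Σ-zero {zero}  zeros = refl
Σ-zero {suc n} zeros = cong₂ ℤ._+_ (zeros zero) (Σ-zero (zeros ∘ suc))

clear : ∀ {n} → Fin n → (Fin n → ℤ) → Fin n → ℤ
clear a v j with j Fin.≟ a
... | yes _ = + 0
... | no _  = v j

clear-off : ∀ {n} {a : Fin n} v {j} → j ≢ a → clear a v j ≡ v j
clear-off {a = a} v {j} j≢a with j Fin.≟ a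
... | yes e = contradiction e j≢a
... | no _  = refl

-- Extracts one entry at a time, so that a line with one or three nonzero entries can be summed
-- without regard to their positions.
Σ-clear : ∀ {n} (a : Fin n) v → Σℤ v ≡ v a ℤ.+ Σℤ (clear a v)
Σ-clear zero v = cong (λ z → v zero ℤ.+ z) (sym (ℤ.+-identityˡ (Σℤ (v ∘ suc))))
Σ-clear (suc a) v = begin
  v zero ℤ.+ Σℤ (v ∘ suc)                                         ≡⟨ cong (λ z → v zero ℤ.+ z) (Σ-clear a (v ∘ suc)) ⟩
  v zero ℤ.+ (v (suc a) ℤ.+ Σℤ (clear a (v ∘ suc)))               ≡⟨ ℤ.+-assoc (v zero) (v (suc a)) _ ⟨
  v zero ℤ.+ v (suc a) ℤ.+ Σℤ (clear a (v ∘ suc))                 ≡⟨ cong (λ z → z ℤ.+ Σℤ (clear a (v ∘ suc)))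
                                                                        (ℤ.+-comm (v zero) (v (suc a))) ⟩
  v (suc a) ℤ.+ v zero ℤ.+ Σℤ (clear a (v ∘ suc))                 ≡⟨ ℤ.+-assoc (v (suc a)) (v zero) _ ⟩
  v (suc a) ℤ.+ (v zero ℤ.+ Σℤ (clear a (v ∘ suc)))               ≡⟨ cong (λ z → v (suc a) ℤ.+ (v zero ℤ.+ z)) (Σℤ-cong shifted) ⟩
  v (suc a) ℤ.+ Σℤ (clear (suc a) v)                              ∎
  where
  open ≡-Reasoning
  shifted : ∀ j → clear a (v ∘ suc) j ≡ clear (suc a) v (suc j)
  shifted j with j Fin.≟ a
  ... | yes _ = refl
  ... | no _  = refl

Line : ∀ {n} → (Fin n → ℤ) → Set
Line v = Σℤ v ≡ + 1 × Alternating v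

single-line : ∀ {n} (v : Fin n → ℤ) a → v a ≡ + 1 → (∀ j → j ≢ a → v j ≡ + 0) → Line v
single-line v a va zeros =
  trans (Σ-clear a v) (cong₂ ℤ._+_ va (Σ-zero cleared)) , alternating
  where
  cleared : ∀ j → clear a v j ≡ + 0
  cleared j with j Fin.≟ a
  ... | yes _   = refl
  ... | no  j≢a = zeros j j≢a
  support : ∀ j → v j ≢ + 0 → j ≡ a
  support j vj with j Fin.≟ a
  ... | yes e = e
  ... | no ne = contradiction (zeros j ne) vj
  alternating : Alternating v
  alternating j j′ j<j′ vj vj′ _ = contradiction (trans (support j vj) (sym (support j′ vj′))) (Fin.<⇒≢ j<j′)

triple-line : ∀ {n} (v : Fin n → ℤ) a b c → a <ᶠ b → b <ᶠ c → v a ≡ + 1 → v b ≡ -[1+ 0 ] → v c ≡ + 1 →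
  (∀ j → j ≢ a → j ≢ b → j ≢ c → v j ≡ + 0) → Line v
triple-line v a b c a<b b<c va vb vc zeros = total , alternating
  where
  a<c = Fin.<-trans a<b b<c
  v₁ = clear a v
  v₂ = clear b v₁
  v₁b : v₁ b ≡ -[1+ 0 ]
  v₁b = trans (clear-off v (Fin.<⇒≢ a<b ∘ sym)) vb
  v₂c : v₂ c ≡ + 1
  v₂c = trans (clear-off v₁ (Fin.<⇒≢ b<c ∘ sym)) (trans (clear-off v (Fin.<⇒≢ a<c ∘ sym)) vc)
  cleared : ∀ j → clear c v₂ j ≡ + 0
  cleared j with j Fin.≟ c
  ... | yes _ = refl
  ... | no j≢c with j Fin.≟ b
  ...   | yes _ = refl
  ...   | no j≢b with j Fin.≟ a
  ...     | yes _   = refl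
  ...     | no  j≢a = zeros j j≢a j≢b j≢c
  total : Σℤ v ≡ + 1
  total = begin
    Σℤ v                                                ≡⟨ Σ-clear a v ⟩
    v a ℤ.+ Σℤ v₁                                       ≡⟨ cong (λ z → v a ℤ.+ z) (Σ-clear b v₁) ⟩
    v a ℤ.+ (v₁ b ℤ.+ Σℤ v₂)                            ≡⟨ cong (λ z → v a ℤ.+ (v₁ b ℤ.+ z)) (Σ-clear c v₂) ⟩
    v a ℤ.+ (v₁ b ℤ.+ (v₂ c ℤ.+ Σℤ (clear c v₂)))       ≡⟨ cong₂ ℤ._+_ va (cong₂ ℤ._+_ v₁b (cong₂ ℤ._+_ v₂c (Σ-zero cleared))) ⟩
    + 1                                                 ∎
    where open ≡-Reasoning
  support : ∀ j → v j ≢ + 0 → j ≡ a ⊎ j ≡ b ⊎ j ≡ c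
  support j vj with j Fin.≟ a | j Fin.≟ b | j Fin.≟ c
  ... | yes e | _     | _     = inj₁ e
  ... | no _  | yes e | _     = inj₂ (inj₁ e)
  ... | no _  | no _  | yes e = inj₂ (inj₂ e)
  ... | no x  | no y  | no z  = contradiction (zeros j x y z) vj
  alternating : Alternating v
  alternating j j′ j<j′ vj vj′ between with support j vj | support j′ vj′
  ... | inj₁ refl        | inj₁ refl        = contradiction j<j′ (Fin.<-irrefl refl)
  ... | inj₁ refl        | inj₂ (inj₁ refl) = λ e → contradiction (trans (sym va) (trans e vb)) λ ()
  ... | inj₁ refl        | inj₂ (inj₂ refl) = contradiction (trans (sym (between b a<b b<c)) vb) λ ()
  ... | inj₂ (inj₁ refl) | inj₁ refl        = contradiction j<j′ (Fin.<-asym a<b)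
  ... | inj₂ (inj₁ refl) | inj₂ (inj₁ refl) = contradiction j<j′ (Fin.<-irrefl refl)
  ... | inj₂ (inj₁ refl) | inj₂ (inj₂ refl) = λ e → contradiction (trans (sym vb) (trans e vc)) λ ()
  ... | inj₂ (inj₂ refl) | inj₁ refl        = contradiction j<j′ (Fin.<-asym a<c)
  ... | inj₂ (inj₂ refl) | inj₂ (inj₁ refl) = contradiction j<j′ (Fin.<-asym b<c)
  ... | inj₂ (inj₂ refl) | inj₂ (inj₂ refl) = contradiction j<j′ (Fin.<-irrefl refl)

-- The block matrix of a permutation

Centre : ∀ {m} → Permutation′ m → ℕ → ℕ → Set
Centre {m} π u v = ∃ λ p → u ≡ m + toℕ p × v ≡ m + toℕ (π ⟨$⟩ʳ p)

centre? : ∀ {m} (π : Permutation′ m) u v → Dec (Centre π u v)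
centre? {m} π u v = Fin.any? λ p → (u ℕ.≟ m + toℕ p) ×-dec (v ℕ.≟ m + toℕ (π ⟨$⟩ʳ p))

-- In m × m blocks, the matrix with rows [0 I 0], [I -π I], [0 I 0].
data Cell {m} (π : Permutation′ m) (u v : ℕ) : ℤ → Set where
  upper  : v ≡ u + m → Cell π u v (+ 1)
  lower  : u ≡ v + m → Cell π u v (+ 1)
  centre : Centre π u v → Cell π u v -[1+ 0 ]
  empty  : v ≢ u + m → u ≢ v + m → ¬ Centre π u v → Cell π u v (+ 0)

cell : ∀ {m} (π : Permutation′ m) u v → ∃ (Cell π u v)
cell {m} π u v with v ℕ.≟ u + m | u ℕ.≟ v + m | centre? π u v
... | yes e | _     | _     = _ , upper e
... | no _  | yes e | _     = _ , lower e
... | no _  | no _  | yes e = _ , centre e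
... | no p  | no q  | no r  = _ , empty p q r

-- Transposing exchanges the two diagonals and inverts `π`, so the columns of the block matrix are
-- rows of another one.
swap-cell : ∀ {m} {π : Permutation′ m} {u v x} → Cell π u v x → Cell (flip π) v u x
swap-cell (upper e) = lower e
swap-cell (lower e) = upper e
swap-cell {π = π} (centre (p , up , vp)) = centre (π ⟨$⟩ʳ p , vp , trans up (cong (λ z → _ + toℕ z) (sym (inverseˡ π))))
swap-cell {π = π} (empty p q r) = empty q p λ { (i , vi , ui) →
  r (π ⟨$⟩ˡ i , ui , trans vi (cong (λ z → _ + toℕ z) (sym (inverseʳ π)))) }

-- Coordinates within the middle block differ by less than `m`, on the diagonal by exactly `m`.
¬upper×centre : ∀ {m} (π : Permutation′ m) {u v} → v ≡ u + m → ¬ Centre π u v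
¬upper×centre {m} π refl (p , refl , e) = ℕ.<-irrefl (sym e)
  (ℕ.<-≤-trans (ℕ.+-monoʳ-< m (Fin.toℕ<n (π ⟨$⟩ʳ p))) (ℕ.+-monoˡ-≤ m (ℕ.m≤m+n m (toℕ p))))

¬lower×centre : ∀ {m} (π : Permutation′ m) {u v} → u ≡ v + m → ¬ Centre π u v
¬lower×centre {m} π refl (p , e , refl) = ℕ.<-irrefl (sym e)
  (ℕ.<-≤-trans (ℕ.+-monoʳ-< m (Fin.toℕ<n p)) (ℕ.+-monoˡ-≤ m (ℕ.m≤m+n m (toℕ (π ⟨$⟩ʳ p)))))

-- The two diagonals meet only for `m = 0`, and there both prescribe 1.
cell-unique : ∀ {m} {π : Permutation′ m} {u v x y} → Cell π u v x → Cell π u v y → x ≡ y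
cell-unique (upper _)     (upper _)     = refl
cell-unique (upper _)     (lower _)     = refl
cell-unique {π = π} (upper e)     (centre c)    = contradiction c (¬upper×centre π e)
cell-unique (upper e)     (empty p _ _) = contradiction e p
cell-unique (lower _)     (upper _)     = refl
cell-unique (lower _)     (lower _)     = refl
cell-unique {π = π} (lower e)     (centre c)    = contradiction c (¬lower×centre π e)
cell-unique (lower e)     (empty _ q _) = contradiction e q
cell-unique {π = π} (centre c)    (upper e)     = contradiction c (¬upper×centre π e)
cell-unique {π = π} (centre c)    (lower e)     = contradiction c (¬lower×centre π e)
cell-unique (centre _)    (centre _)    = refl
cell-unique (centre c)    (empty _ _ r) = contradiction c r
cell-unique (empty p _ _) (upper e)     = contradiction e p
cell-unique (empty _ q _) (lower e)     = contradiction e q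
cell-unique (empty _ _ r) (centre c)    = contradiction c r
cell-unique (empty _ _ _) (empty _ _ _) = refl

blockMatrix : ∀ {m} → Permutation′ m → Matrix (m * 3)
blockMatrix π i j = proj₁ (cell π (toℕ i) (toℕ j))

module _ {m} (π : Permutation′ m) where

  private
    A = blockMatrix π
    A-cell : ∀ i j → Cell π (toℕ i) (toℕ j) (A i j)
    A-cell i j = proj₂ (cell π (toℕ i) (toℕ j))

  blockMatrix-cell : ∀ i j {x} → Cell π (toℕ i) (toℕ j) x → A i j ≡ x
  blockMatrix-cell i j c = cell-unique (A-cell i j) c

  blockMatrix-entry : ∀ i j → Entry (A i j)
  blockMatrix-entry i j with A i j | A-cell i j
  ... | _ | upper _     = inj₂ (inj₁ refl)
  ... | _ | lower _     = inj₂ (inj₁ refl)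
  ... | _ | centre _    = inj₂ (inj₂ refl)
  ... | _ | empty _ _ _ = inj₁ refl

  blockMatrix-zero : ∀ i j → toℕ j ≢ toℕ i + m → toℕ i ≢ toℕ j + m → ¬ Centre π (toℕ i) (toℕ j) → A i j ≡ + 0
  blockMatrix-zero i j p q r = blockMatrix-cell i j (empty p q r)

  private
    3m : m * 3 ≡ m + (m + m)
    3m = trans (ℕ.*-comm m 3) (cong (λ z → m + (m + z)) (ℕ.+-identityʳ m))

    at : ∀ {x} → x < m + (m + m) → Fin (m * 3)
    at {x} x< = fromℕ< (subst (x <_) (sym 3m) x<)

    toℕ-at : ∀ {x} (x< : x < m + (m + m)) → toℕ (at x<) ≡ x
    toℕ-at x< = Fin.toℕ-fromℕ< _

    other : ∀ {x} (x< : x < m + (m + m)) {j} → j ≢ at x< → toℕ j ≢ x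
    other x< j≢ e = j≢ (Fin.toℕ-injective (trans e (sym (toℕ-at x<))))

    m≤2m : m ≤ m + m
    m≤2m = ℕ.m≤m+n m m

  -- Rows of the top and bottom bands contain a single 1. Row `m + p` of the middle band contains 1,
  -- -1, 1 in columns `p`, `m + π(p)` and `m + p + m`.
  blockMatrix-row : ∀ i → Line (A i)
  blockMatrix-row i with toℕ i <? m
  ... | yes u<m = single-line (A i) (at c<)
    (blockMatrix-cell i (at c<) (upper (toℕ-at c<)))
    (λ j j≢ → blockMatrix-zero i j (other c< j≢)
      (λ e → contradiction (subst (m ≤_) (sym e) (ℕ.m≤n+m m (toℕ j))) (ℕ.<⇒≱ u<m))
      (λ (p , e , _) → contradiction (subst (m ≤_) (sym e) (ℕ.m≤m+n m (toℕ p))) (ℕ.<⇒≱ u<m)))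
    where
    c< : toℕ i + m < m + (m + m)
    c< = ℕ.+-mono-<-≤ u<m m≤2m
  ... | no u≮m with toℕ i <? m + m
  ...   | yes u<2m = triple-line (A i) (at a<) (at b<) (at c<)
    (subst₂ _<_ (sym (toℕ-at a<)) (sym (toℕ-at b<)) (ℕ.<-≤-trans (Fin.toℕ<n p) (ℕ.m≤m+n m _)))
    (subst₂ _<_ (sym (toℕ-at b<)) (sym (toℕ-at c<))
      (ℕ.<-≤-trans (ℕ.+-monoʳ-< m (Fin.toℕ<n (π ⟨$⟩ʳ p))) (ℕ.+-monoˡ-≤ m (ℕ.≮⇒≥ u≮m))))
    (blockMatrix-cell i (at a<) (lower (trans u≡ (trans (ℕ.+-comm m (toℕ p)) (cong (λ z → z + m) (sym (toℕ-at a<)))))))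
    (blockMatrix-cell i (at b<) (centre (p , u≡ , toℕ-at b<)))
    (blockMatrix-cell i (at c<) (upper (toℕ-at c<)))
    (λ j j≢a j≢b j≢c → blockMatrix-zero i j (other c< j≢c)
      (λ e → other a< j≢a (ℕ.+-cancelʳ-≡ m _ _ (trans (sym e) (trans u≡ (ℕ.+-comm m (toℕ p))))))
      (λ (q , e , e′) → other b< j≢b (trans e′ (cong (λ z → m + toℕ (π ⟨$⟩ʳ z))
        (Fin.toℕ-injective (ℕ.+-cancelˡ-≡ m _ _ (trans (sym e) u≡)))))))
    where
    p<m : toℕ i ∸ m < m
    p<m = ℕ.+-cancelˡ-< m _ _ (subst (_< m + m) (sym (ℕ.m+[n∸m]≡n (ℕ.≮⇒≥ u≮m))) u<2m)
    p : Fin m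
    p = fromℕ< p<m
    u≡ : toℕ i ≡ m + toℕ p
    u≡ = trans (sym (ℕ.m+[n∸m]≡n (ℕ.≮⇒≥ u≮m))) (cong (λ z → m + z) (sym (Fin.toℕ-fromℕ< p<m)))
    a< : toℕ p < m + (m + m)
    a< = ℕ.<-≤-trans (Fin.toℕ<n p) (ℕ.m≤m+n m _)
    b< : m + toℕ (π ⟨$⟩ʳ p) < m + (m + m)
    b< = ℕ.+-monoʳ-< m (ℕ.<-≤-trans (Fin.toℕ<n (π ⟨$⟩ʳ p)) m≤2m)
    c< : toℕ i + m < m + (m + m)
    c< = subst (toℕ i + m <_) (ℕ.+-assoc m m m) (ℕ.+-monoˡ-< m u<2m)
  ...   | no u≮2m = single-line (A i) (at a<)
    (blockMatrix-cell i (at a<) (lower (trans u≡ (cong (λ z → z + m) (sym (toℕ-at a<))))))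
    (λ j j≢ → blockMatrix-zero i j
      (λ e → contradiction (subst (m + (m + m) ≤_) (sym e)
               (ℕ.≤-trans (ℕ.≤-reflexive (sym (ℕ.+-assoc m m m))) (ℕ.+-monoˡ-≤ m (ℕ.≮⇒≥ u≮2m))))
               (ℕ.<⇒≱ (subst (toℕ j <_) 3m (Fin.toℕ<n j))))
      (λ e → other a< j≢ (ℕ.+-cancelʳ-≡ m _ _ (trans (sym e) u≡)))
      (λ (p , e , _) → contradiction (subst (_< m + m) (sym e) (ℕ.+-monoʳ-< m (Fin.toℕ<n p))) u≮2m))
    where
    u≡ : toℕ i ≡ toℕ i ∸ m + m
    u≡ = sym (ℕ.m∸n+n≡m (ℕ.≤-trans m≤2m (ℕ.≮⇒≥ u≮2m)))
    a< : toℕ i ∸ m < m + (m + m)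
    a< = ℕ.≤-<-trans (ℕ.m∸n≤m (toℕ i) m) (subst (toℕ i <_) 3m (Fin.toℕ<n i))

  blockMatrix-one : ∀ i j → A i j ≡ + 1 → toℕ j ≡ toℕ i + m ⊎ toℕ i ≡ toℕ j + m
  blockMatrix-one i j e with A i j | A-cell i j | e
  ... | _ | upper p | _ = inj₁ p
  ... | _ | lower p | _ = inj₂ p

  blockMatrix-negative : ∀ i j → A i j ≡ -[1+ 0 ] → Centre π (toℕ i) (toℕ j)
  blockMatrix-negative i j e with A i j | A-cell i j | e
  ... | _ | centre c | _ = c

blockMatrix-transposed : ∀ {m} (π : Permutation′ m) i j → blockMatrix π i j ≡ blockMatrix (flip π) j i
blockMatrix-transposed π i j = sym (blockMatrix-cell (flip π) j i (swap-cell (proj₂ (cell π (toℕ i) (toℕ j)))))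

Line-cong : ∀ {n} {v w : Fin n → ℤ} → (∀ i → v i ≡ w i) → Line v → Line w
Line-cong v≗w (total , alt) = trans (Σℤ-cong (sym ∘ v≗w)) total ,
  λ j j′ j<j′ wj wj′ between e → alt j j′ j<j′ (wj ∘ trans (sym (v≗w j))) (wj′ ∘ trans (sym (v≗w j′)))
    (λ l j<l l<j′ → trans (v≗w l) (between l j<l l<j′)) (trans (v≗w j) (trans e (sym (v≗w j′))))

fromLines : ∀ {n} {A : Matrix n} → (∀ i j → Entry (A i j)) →
  (∀ i → Line (A i)) → (∀ j → Line (λ i → A i j)) → IsASM A
fromLines entry rows columns =
  entry , (λ i → proj₁ (rows i)) , (λ j → proj₁ (columns j)) , (λ i → proj₂ (rows i)) , (λ j → proj₂ (columns j))

blockMatrix-IsASM : ∀ {m} (π : Permutation′ m) → IsASM (blockMatrix π)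
blockMatrix-IsASM π = fromLines (blockMatrix-entry π) (blockMatrix-row π)
  (λ j → Line-cong (λ i → sym (blockMatrix-transposed π i j)) (blockMatrix-row (flip π) j))

DecreasingTriple : ∀ {n} → Matrix n → Set
DecreasingTriple {n} A = Σ (Fin n) λ i₁ → Σ (Fin n) λ i₂ → Σ (Fin n) λ i₃ →
  Σ (Fin n) λ j₁ → Σ (Fin n) λ j₂ → Σ (Fin n) λ j₃ →
  i₁ <ᶠ i₂ × i₂ <ᶠ i₃ × j₂ <ᶠ j₁ × j₃ <ᶠ j₂ × A i₁ j₁ ≡ + 1 × A i₂ j₂ ≡ + 1 × A i₃ j₃ ≡ + 1

same-diagonal : ∀ {m u u′ v v′} → v ≡ u + m → v′ ≡ u′ + m → u < u′ → ¬ (v′ < v)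
same-diagonal {m} refl refl u<u′ = ℕ.<-asym (ℕ.+-monoˡ-< m u<u′)

-- Two of the three entries lie on the same one of the two diagonals of ones.
blockMatrix-no-triple : ∀ {m} (π : Permutation′ m) → ¬ DecreasingTriple (blockMatrix π)
blockMatrix-no-triple {m} π (i₁ , i₂ , i₃ , j₁ , j₂ , j₃ , i₁<i₂ , i₂<i₃ , j₂<j₁ , j₃<j₂ , e₁ , e₂ , e₃)
  with blockMatrix-one π i₁ j₁ e₁ | blockMatrix-one π i₂ j₂ e₂ | blockMatrix-one π i₃ j₃ e₃
... | inj₁ p | inj₁ q | _      = same-diagonal p q i₁<i₂ j₂<j₁
... | inj₂ p | inj₂ q | _      = same-diagonal q p j₂<j₁ i₁<i₂
... | inj₁ p | inj₂ _ | inj₁ r = same-diagonal p r (ℕ.<-trans i₁<i₂ i₂<i₃) (ℕ.<-trans j₃<j₂ j₂<j₁)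
... | inj₂ p | inj₁ _ | inj₂ r = same-diagonal r p (ℕ.<-trans j₃<j₂ j₂<j₁) (ℕ.<-trans i₁<i₂ i₂<i₃)
... | inj₁ _ | inj₂ q | inj₂ r = same-diagonal r q j₃<j₂ i₂<i₃
... | inj₂ _ | inj₁ q | inj₁ r = same-diagonal q r i₂<i₃ j₃<j₂

-- The permutation can be read off from the positions of the minus ones.
blockMatrix-injective : ∀ {m} (π ρ : Permutation′ m) → (∀ i j → blockMatrix π i j ≡ blockMatrix ρ i j) →
  ∀ p → π ⟨$⟩ʳ p ≡ ρ ⟨$⟩ʳ p
blockMatrix-injective {m} π ρ same p = matched (blockMatrix-negative ρ i j (trans (sym (same i j))
    (blockMatrix-cell π i j (centre (p , Fin.toℕ-fromℕ< (small p) , Fin.toℕ-fromℕ< (small (π ⟨$⟩ʳ p)))))))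
  where
  small : ∀ (q : Fin m) → m + toℕ q < m * 3
  small q = subst (m + toℕ q <_) (sym (ℕ.*-comm m 3)) (ℕ.+-monoʳ-< m (ℕ.<-≤-trans (Fin.toℕ<n q) (ℕ.m≤m+n m _)))
  i = fromℕ< (small p)
  j = fromℕ< (small (π ⟨$⟩ʳ p))
  matched : Centre ρ (toℕ i) (toℕ j) → π ⟨$⟩ʳ p ≡ ρ ⟨$⟩ʳ p
  matched (q , e , e′) = Fin.toℕ-injective (ℕ.+-cancelˡ-≡ m _ _
    (trans (sym (Fin.toℕ-fromℕ< (small (π ⟨$⟩ʳ p)))) (trans e′ (cong (λ z → m + toℕ (ρ ⟨$⟩ʳ z)) (sym p≡q)))))
    where
    p≡q : p ≡ q
    p≡q = Fin.toℕ-injective (ℕ.+-cancelˡ-≡ m _ _ (trans (sym (Fin.toℕ-fromℕ< (small p))) e))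

-- Padding by an identity block

1⊕ : ∀ {n} → Matrix n → Matrix (suc n)
1⊕ A zero    zero    = + 1
1⊕ A zero    (suc j) = + 0
1⊕ A (suc i) zero    = + 0
1⊕ A (suc i) (suc j) = A i j

shift-line : ∀ {n} {v : Fin (suc n) → ℤ} → v zero ≡ + 0 → Line (v ∘ suc) → Line v
shift-line {v = v} v0 (total , alt) = trans (cong (λ z → z ℤ.+ Σℤ (v ∘ suc)) v0)
  (trans (ℤ.+-identityˡ _) total) , λ where
  zero    j′       _         vj _   _       → contradiction v0 vj
  (suc j) (suc j′) (s≤s j<j′) vj vj′ between → alt j j′ j<j′ vj vj′ λ l j<l l<j′ → between (suc l) (s≤s j<l) (s≤s l<j′)

1⊕-IsASM : ∀ {n} {A : Matrix n} → IsASM A → IsASM (1⊕ A)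
1⊕-IsASM {A = A} (entry , rowSum , columnSum , rowAlt , columnAlt) = fromLines entry′
  (λ { zero    → single-line (1⊕ A zero) zero refl (λ { zero ne → contradiction refl ne ; (suc j) _ → refl })
     ; (suc i) → shift-line refl (rowSum i , rowAlt i) })
  (λ { zero    → single-line (λ i → 1⊕ A i zero) zero refl (λ { zero ne → contradiction refl ne ; (suc j) _ → refl })
     ; (suc j) → shift-line refl (columnSum j , columnAlt j) })
  where
  entry′ : ∀ i j → Entry (1⊕ A i j)
  entry′ zero    zero    = inj₂ (inj₁ refl)
  entry′ zero    (suc j) = inj₁ refl
  entry′ (suc i) zero    = inj₁ refl
  entry′ (suc i) (suc j) = entry i j

-- The corner is the only 1 in the first row and column, and no position is to its lower left or
-- upper right, so it belongs to no decreasing triple.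
1⊕-no-triple : ∀ {n} {A : Matrix n} → ¬ DecreasingTriple A → ¬ DecreasingTriple (1⊕ A)
1⊕-no-triple none (suc i₁ , suc i₂ , suc i₃ , suc j₁ , suc j₂ , suc j₃ , s≤s p , s≤s q , s≤s r , s≤s t , e) =
  none (i₁ , i₂ , i₃ , j₁ , j₂ , j₃ , p , q , r , t , e)
1⊕-no-triple none (suc i₁ , suc i₂ , suc i₃ , suc j₁ , suc j₂ , zero , _ , _ , _ , _ , _ , _ , ())
1⊕-no-triple none (zero , suc i₂ , suc i₃ , suc j₁ , j₂ , j₃ , _ , _ , _ , _ , () , _)

padded : ∀ r {m} → Permutation′ m → Matrix (r + m * 3)
padded zero    π = blockMatrix π
padded (suc r) π = 1⊕ (padded r π)

padded-IsASM : ∀ r {m} (π : Permutation′ m) → IsASM (padded r π)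
padded-IsASM zero    π = blockMatrix-IsASM π
padded-IsASM (suc r) π = 1⊕-IsASM (padded-IsASM r π)

padded-no-triple : ∀ r {m} (π : Permutation′ m) → ¬ DecreasingTriple (padded r π)
padded-no-triple zero    π = blockMatrix-no-triple π
padded-no-triple (suc r) π = 1⊕-no-triple (padded-no-triple r π)

padded-injective : ∀ r {m} (π ρ : Permutation′ m) → (∀ i j → padded r π i j ≡ padded r ρ i j) →
  ∀ p → π ⟨$⟩ʳ p ≡ ρ ⟨$⟩ʳ p
padded-injective zero    π ρ same = blockMatrix-injective π ρ same
padded-injective (suc r) π ρ same = padded-injective r π ρ (λ i j → same (suc i) (suc j))

-- Enumeration of the permutations

permutations : ∀ m → Fin (m !) → Permutation′ m
permutations zero    _ = idₚ
permutations (suc m) x = insert zero (proj₁ (remQuot {suc m} (m !) x)) (permutations m (proj₂ (remQuot {suc m} (m !) x)))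

-- The leading digit of the index is the image of `zero`; once it is known, injectivity of `punchIn`
-- recovers the permutation coded by the remaining digits.
permutations-injective : ∀ m x y → (∀ p → permutations m x ⟨$⟩ʳ p ≡ permutations m y ⟨$⟩ʳ p) → x ≡ y
permutations-injective zero    zero zero _ = refl
permutations-injective (suc m) x    y    same = begin
  x                            ≡⟨ Fin.combine-remQuot {suc m} (m !) x ⟨
  combine (first x) (rest x)   ≡⟨ cong₂ combine (same zero) (permutations-injective m (rest x) (rest y) same-rest) ⟩
  combine (first y) (rest y)   ≡⟨ Fin.combine-remQuot {suc m} (m !) y ⟩
  y                            ∎
  where
  open ≡-Reasoning
  first : Fin (suc m !) → Fin (suc m)
  first x = proj₁ (remQuot {suc m} (m !) x)
  rest : Fin (suc m !) → Fin (m !)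
  rest x = proj₂ (remQuot {suc m} (m !) x)
  same-rest : ∀ p → permutations m (rest x) ⟨$⟩ʳ p ≡ permutations m (rest y) ⟨$⟩ʳ p
  same-rest p = Fin.punchIn-injective (first x) _ _ (begin
    punchIn (first x) (permutations m (rest x) ⟨$⟩ʳ p)   ≡⟨ insert-punchIn zero (first x) (permutations m (rest x)) p ⟨
    permutations (suc m) x ⟨$⟩ʳ suc p                    ≡⟨ same (suc p) ⟩
    permutations (suc m) y ⟨$⟩ʳ suc p                    ≡⟨ insert-punchIn zero (first y) (permutations m (rest y)) p ⟩
    punchIn (first y) (permutations m (rest y) ⟨$⟩ʳ p)   ≡⟨ cong (λ z → punchIn z (permutations m (rest y) ⟨$⟩ʳ p)) (same zero) ⟨
    punchIn (first x) (permutations m (rest y) ⟨$⟩ʳ p)   ∎)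

-- Column reversal and the factorial lower bound

mirror : ∀ {n} → Matrix n → Matrix n
mirror A i j = A i (opposite j)

opposite-< : ∀ {n} {i j : Fin n} → i <ᶠ j → opposite j <ᶠ opposite i
opposite-< {i = i} {j} i<j = subst₂ _<_ (sym (Fin.opposite-prop j)) (sym (Fin.opposite-prop i))
  (ℕ.∸-monoʳ-< (s≤s i<j) (Fin.toℕ<n j))

mirror-IsASM : ∀ {n} {A : Matrix n} → IsASM A → IsASM (mirror A)
mirror-IsASM {A = A} (entry , rowSum , columnSum , rowAlt , columnAlt) =
  (λ i j → entry i (opposite j)) ,
  (λ i → trans (sym (Σℤ-permute (A i) reverse)) (rowSum i)) ,
  (λ j → columnSum (opposite j)) ,
  -- Reversal exchanges the order of the two positions, so alternation is applied to the swapped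
  -- pair and the inequality turned around.
  (λ i j j′ j<j′ vj vj′ between → rowAlt i (opposite j′) (opposite j) (opposite-< j<j′) vj′ vj
     (λ l j′<l l<j → trans (cong (A i) (sym (Fin.opposite-involutive l)))
        (between (opposite l) (subst (_<ᶠ opposite l) (Fin.opposite-involutive j) (opposite-< l<j))
                              (subst (opposite l <ᶠ_) (Fin.opposite-involutive j′) (opposite-< j′<l)))) ∘ sym) ,
  (λ j → columnAlt (opposite j))

mirror-injective : ∀ {n} {A B : Matrix n} → (∀ i j → mirror A i j ≡ mirror B i j) → ∀ i j → A i j ≡ B i j
mirror-injective {A = A} {B} same i j = subst (λ z → A i z ≡ B i z) (Fin.opposite-involutive j) (same i (opposite j))

avoids-decreasing : ∀ {k n} (σ : Permutation′ k) → MonotoneTriple (λ a b → b < a) σ →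
  {A : Matrix n} → ¬ DecreasingTriple A → Avoids A σ
avoids-decreasing σ (i , j , l , i<j , j<l , σj<σi , σl<σj) none (f , g , f↑ , g↑ , hit) =
  none (f i , f j , f l , g (σ ⟨$⟩ʳ i) , g (σ ⟨$⟩ʳ j) , g (σ ⟨$⟩ʳ l) ,
        f↑ i j i<j , f↑ j l j<l , g↑ _ _ σj<σi , g↑ _ _ σl<σj , hit i , hit j , hit l)

avoids-increasing : ∀ {k n} (σ : Permutation′ k) → MonotoneTriple _<_ σ →
  {A : Matrix n} → ¬ DecreasingTriple A → Avoids (mirror A) σ
avoids-increasing σ (i , j , l , i<j , j<l , σi<σj , σj<σl) none (f , g , f↑ , g↑ , hit) =
  none (f i , f j , f l , opposite (g (σ ⟨$⟩ʳ i)) , opposite (g (σ ⟨$⟩ʳ j)) , opposite (g (σ ⟨$⟩ʳ l)) ,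
        f↑ i j i<j , f↑ j l j<l , opposite-< (g↑ _ _ σi<σj) , opposite-< (g↑ _ _ σj<σl) , hit i , hit j , hit l)

factorially-many : ∀ {k} r m (σ : Permutation′ k) →
  MonotoneTriple _<_ σ ⊎ MonotoneTriple (λ a b → b < a) σ → CardGe (r + m * 3) σ (m !)
factorially-many r m σ (inj₁ increasing) =
  (λ x → let A = padded r (permutations m x) in
    mirror A , mirror-IsASM (padded-IsASM r (permutations m x)) ,
    avoids-increasing σ increasing (padded-no-triple r (permutations m x))) ,
  λ x y same → permutations-injective m x y (padded-injective r _ _ (mirror-injective same))
factorially-many r m σ (inj₂ decreasing) =
  (λ x → padded r (permutations m x) , padded-IsASM r (permutations m x) ,
    avoids-decreasing σ decreasing (padded-no-triple r (permutations m x))) ,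
  λ x y same → permutations-injective m x y (padded-injective r _ _ same)

lower-bound : ∀ {k} → 1 ≤ k → (σ : Permutation′ k) → ¬ InX σ → ∀ n → CardGe n σ ((n / 3) !)
-- Blocks of side `n / 3`, with the remainder `n % 3` as the size of the identity padding.
lower-bound 1≤k σ ∉X n = subst (λ N → CardGe N σ ((n / 3) !)) (sym (m≡m%n+[m/n]*n n 3))
  (factorially-many (n % 3) (n / 3) σ (∉X⇒triple 1≤k σ ∉X))

theorem1p1 : (k : ℕ) → 1 ≤ k → (σ : Permutation′ k) →
    (InX σ → Σ ℕ (λ c → (n : ℕ) → CardLe n σ (c ^ n)))
    × (¬ InX σ → (n : ℕ) → CardGe n σ ((n / 3) !))
theorem1p1 (suc m) 1≤k σ = (λ σ∈X → upper-bound σ (InX⇒Outer σ σ∈X)) , lower-bound 1≤k σ
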